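{- Topological Hitting Set admits an FPT algorithm with respect to the parameter $k+\Delta$, where $\Delta$ is the maximum degree of the Hasse graph of the input complex $K$ and $k$ is the solution size. The algorithm runs in $O\bigl(n^{6+\omega}\cdot 2^{O(k\log(k\Delta))}\bigr)$ time, where $n$ is the size of the complex and $\omega$ is the exponent of matrix multiplication.
   Context: Homology is simplicial with $\mathbb{Z}_2$ coefficients; chains are identified with sets of simplices. Topological Hitting Set: given a $d$-dimensional simplicial complex $K$, a natural number $k$, a natural number $r<d$, and a non-bounding cycle $\zeta\in Z_r(K)$, decide whether there exists a set $S$ of $r$-dimensional simplices of $K$ with $|S|\le k$ that meets every cycle homologous to $\zeta$ (and find such a set of minimum size if one exists). The Hasse graph of $K$ has a node for every simplex of $K$ and an edge for every facet-cofacet pair. The size $n$ of $K$ is its number of simplices. An FPT algorithm with respect to a parameter $p$ is one running in time $f(p)\cdot|I|^{O(1)}$ on instance $I$ for some computable function $f$. -}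

module Defs where

open import Data.Bool using (Bool; true; false; if_then_else_; _∧_; _∨_; _xor_)
open import Data.Bool.Properties using (xor-∧-commutativeRing)
open import Data.Fin using (Fin; toℕ)
open import Data.Fin.Subset using (Subset; Nonempty; _∈_; _⊆_; _∩_; ∣_∣; ⁅_⁆)
open import Data.Fin.Subset.Properties using (_⊆?_)
open import Data.List using (List; []; _∷_; _++_; length; map; concatMap; allFin)
import Data.List as List
open import Data.List.Extrema.Nat using (max)
open import Data.Nat
  using (ℕ; zero; suc; _+_; _*_; _∸_; _^_; _≤_; _<_; _≡ᵇ_; NonZero)
open import Data.Nat.Properties using (_≟_)
open import Data.Product using (Σ; ∃; ∃-syntax; _×_; _,_)
open import Data.Vec using (Vec; []; _∷_; lookup; tabulate; toList; zipWith; replicate)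
open import Relation.Binary.PropositionalEquality using (_≡_)
open import Relation.Nullary using (¬_; Dec)
open import Relation.Nullary.Decidable using (⌊_⌋; _×-dec_)
open import Algebra.Bundles using (CommutativeRing)
open import Algebra.Properties.CommutativeMonoid.Sum
  (CommutativeRing.+-commutativeMonoid xor-∧-commutativeRing)
  using () renaming (sum to ∑₂) public

-- ℤ₂ is Bool with addition _xor_ and multiplication _∧_; ∑₂ is summation in ℤ₂.

------------------------------------------------------------------------
-- Random access machines

-- The machine has a fixed supply of arrays, each indexed by ℕ and holding
-- natural numbers.  The number of the array accessed is part of the program
-- text; the index is computed.  A register is a cell at a literal index.
Memory : Set
Memory = ℕ → ℕ → ℕ

data Expr : Set where
  lit      : ℕ → Expr
  read     : (array : ℕ) (index : Expr) → Expr
  _⊕_ _⊖_  : Expr → Expr → Expr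

data Program : Set where
  skip          : Program
  write         : (array : ℕ) (index value : Expr) → Program
  _⨟_           : Program → Program → Program
  if_then_else′_ : Expr → Program → Program → Program
  while_loop_   : Expr → Program → Program

infixl 6 _⊕_ _⊖_
infixr 3 _⨟_
infix  4 if_then_else′_ while_loop_

⟦_⟧ : Expr → Memory → ℕ
⟦ lit x    ⟧ M = x
⟦ read a e ⟧ M = M a (⟦ e ⟧ M)
⟦ e ⊕ e′   ⟧ M = ⟦ e ⟧ M + ⟦ e′ ⟧ M
⟦ e ⊖ e′   ⟧ M = ⟦ e ⟧ M ∸ ⟦ e′ ⟧ M

-- Uniform cost.  Addition and truncated subtraction are the only arithmetic
-- operations; unit-cost multiplication would make the machine unrealistic.
cost : Expr → ℕ
cost (lit x)    = 1
cost (read a e) = 1 + cost e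
cost (e ⊕ e′)   = 1 + (cost e + cost e′)
cost (e ⊖ e′)   = 1 + (cost e + cost e′)

update : Memory → (array index value : ℕ) → Memory
update M a i x b j = if (a ≡ᵇ b) ∧ (i ≡ᵇ j) then x else M b j

-- ⟨ P , M ⟩⇓⟨ M′ , t ⟩ : started on M, the program P halts with memory M′
-- after t steps.  A guard is true when it is non-zero.
infix 4 ⟨_,_⟩⇓⟨_,_⟩

data ⟨_,_⟩⇓⟨_,_⟩ : Program → Memory → Memory → ℕ → Set where

  ⇓skip : ∀ {M} → ⟨ skip , M ⟩⇓⟨ M , 1 ⟩

  ⇓write : ∀ {a e e′ M} →
    ⟨ write a e e′ , M ⟩⇓⟨ update M a (⟦ e ⟧ M) (⟦ e′ ⟧ M) , 1 + (cost e + cost e′) ⟩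

  ⇓seq : ∀ {P Q M M′ M″ t t′} →
    ⟨ P , M ⟩⇓⟨ M′ , t ⟩ → ⟨ Q , M′ ⟩⇓⟨ M″ , t′ ⟩ →
    ⟨ P ⨟ Q , M ⟩⇓⟨ M″ , t + t′ ⟩

  ⇓then : ∀ {e x P Q M M′ t} → ⟦ e ⟧ M ≡ suc x →
    ⟨ P , M ⟩⇓⟨ M′ , t ⟩ →
    ⟨ if e then P else′ Q , M ⟩⇓⟨ M′ , 1 + (cost e + t) ⟩

  ⇓else : ∀ {e P Q M M′ t} → ⟦ e ⟧ M ≡ 0 →
    ⟨ Q , M ⟩⇓⟨ M′ , t ⟩ →
    ⟨ if e then P else′ Q , M ⟩⇓⟨ M′ , 1 + (cost e + t) ⟩

  ⇓done : ∀ {e P M} → ⟦ e ⟧ M ≡ 0 →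
    ⟨ while e loop P , M ⟩⇓⟨ M , 1 + cost e ⟩

  ⇓loop : ∀ {e x P M M′ M″ t t′} → ⟦ e ⟧ M ≡ suc x →
    ⟨ P , M ⟩⇓⟨ M′ , t ⟩ → ⟨ while e loop P , M′ ⟩⇓⟨ M″ , t′ ⟩ →
    ⟨ while e loop P , M ⟩⇓⟨ M″ , 1 + (cost e + (t + t′)) ⟩

-- The input occupies an initial segment of array 0, every other cell being 0;
-- the output is an initial segment of array 1.
cell : List ℕ → ℕ → ℕ
cell []       i       = 0
cell (x ∷ xs) zero    = x
cell (x ∷ xs) (suc i) = cell xs i

load : List ℕ → Memory
load xs zero    i = cell xs i
load xs (suc a) i = 0

Output : Memory → List ℕ → Set
Output M ys = (i : Fin (length ys)) → M 1 (toℕ i) ≡ List.lookup ys i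

-- On input xs, the program P halts after t steps with output ys.
Run : Program → (xs ys : List ℕ) (t : ℕ) → Set
Run P xs ys t = ∃[ M ] (⟨ P , load xs ⟩⇓⟨ M , t ⟩ × Output M ys)

Computable : (ℕ → ℕ) → Set
Computable f = ∃[ P ] ∀ x → ∃[ t ] Run P (x ∷ []) (f x ∷ []) t

------------------------------------------------------------------------
-- Problems, algorithms, fixed-parameter tractability

record Problem : Set₁ where
  field
    Instance : Set
    encode   : Instance → List ℕ
    Answer   : Instance → List ℕ → Set   -- the acceptable outputs

  size : Instance → ℕ
  size I = length (encode I)

record Algorithm (Π : Problem) : Set where
  open Problem Π
  field
    program : Program
    output  : Instance → List ℕ
    time    : Instance → ℕ
    runs    : ∀ I → Run program (encode I) (output I) (time I)
    correct : ∀ I → Answer I (output I)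

IsFPT : {Π : Problem} → Algorithm Π → (parameter : Problem.Instance Π → ℕ) → Set
IsFPT {Π} A p =
  ∃[ f ] ∃[ c ] (Computable f × (∀ I → time I ≤ f (p I) * size I ^ c))
  where
  open Problem Π
  open Algorithm A

------------------------------------------------------------------------
-- The exponent of matrix multiplication

Matrix : ℕ → Set
Matrix m = Fin m → Fin m → Bool

_⊗_ : ∀ {m} → Matrix m → Matrix m → Matrix m
(A ⊗ B) i j = ∑₂ (λ l → A i l ∧ B l j)

-- Straight-line programs over ℤ₂ whose inputs are the entries of two m × m
-- matrices; w counts the results computed so far, the latest one having
-- index zero.
data Operand (m w : ℕ) : Set where
  const       : Bool → Operand m w
  left right  : Fin m → Fin m → Operand m w
  result      : Fin w → Operand m w

data Gate (m w : ℕ) : Set where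
  add mul : Operand m w → Operand m w → Gate m w

data StraightLine (m : ℕ) : (w w′ : ℕ) → Set where
  []  : ∀ {w} → StraightLine m w w
  _∷_ : ∀ {w w′} → Gate m w → StraightLine m (suc w) w′ → StraightLine m w w′

module _ {m : ℕ} (A B : Matrix m) where

  operand : ∀ {w} → Operand m w → Vec Bool w → Bool
  operand (const b)   xs = b
  operand (left i j)  xs = A i j
  operand (right i j) xs = B i j
  operand (result l)  xs = lookup xs l

  gate : ∀ {w} → Gate m w → Vec Bool w → Bool
  gate (add u v) xs = operand u xs xor operand v xs
  gate (mul u v) xs = operand u xs ∧ operand v xs

  results : ∀ {w w′} → StraightLine m w w′ → Vec Bool w → Vec Bool w′
  results []      xs = xs
  results (g ∷ P) xs = results P (gate g xs ∷ xs)

-- m × m matrices over ℤ₂ can be multiplied with s arithmetic operations.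
MultipliableWith : (m s : ℕ) → Set
MultipliableWith m s =
  Σ (StraightLine m 0 s) λ P →
  Σ (Fin m → Fin m → Operand m s) λ out →
    ∀ A B i j → operand A B (out i j) (results A B P []) ≡ (A ⊗ B) i j

-- m × m matrices can be multiplied with O(m^(p/q)) operations.  The exponent
-- ω is the infimum of all such rationals p/q.
MultiplicationExponent : (p q : ℕ) → Set
MultiplicationExponent p q =
  ∃[ C ] ∀ m → ∃[ s ] (MultipliableWith m s × s ^ q ≤ C * m ^ p)

-- t ≤ D · n^(e + ω) for the real number ω.  Since x ↦ n^x is continuous and
-- monotone for n ≥ 1, this says t ≤ D · n^(e + p/q) for every admissible p/q,
-- with the same D; the q-th power clears the denominator.
_≤_·_^[_+ω] : (t D n e : ℕ) → Set
t ≤ D · n ^[ e +ω] =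
  ∀ p q → .{{NonZero q}} → MultiplicationExponent p q →
  t ^ q ≤ D ^ q * n ^ (e * q + p)

------------------------------------------------------------------------
-- Simplicial complexes and homology with ℤ₂ coefficients

record Complex : Set where
  field
    vertices  : ℕ
    n         : ℕ
    simplex   : Fin n → Subset vertices
    distinct  : ∀ {i j} → simplex i ≡ simplex j → i ≡ j
    nonempty  : ∀ i → Nonempty (simplex i)
    closed    : ∀ i (τ : Subset vertices) → Nonempty τ → τ ⊆ simplex i →
                ∃[ j ] simplex j ≡ τ
    singleton : ∀ x → ∃[ j ] simplex j ≡ ⁅ x ⁆

  dim : Fin n → ℕ
  dim i = ∣ simplex i ∣ ∸ 1

  dimension : ℕ
  dimension = max 0 (map dim (allFin n))

  IsFacet : Fin n → Fin n → Set
  IsFacet i j = simplex i ⊆ simplex j × dim j ≡ suc (dim i)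

  isFacet? : ∀ i j → Dec (IsFacet i j)
  isFacet? i j = (simplex i ⊆? simplex j) ×-dec (dim j ≟ suc (dim i))

  -- A set of simplices, as well as its characteristic function in ℤ₂.
  Chain : Set
  Chain = Subset n

  OfDim : ℕ → Chain → Set
  OfDim r c = ∀ {i} → i ∈ c → dim i ≡ r

  ∅ : Chain
  ∅ = replicate n false

  infixl 6 _⊞_
  _⊞_ : Chain → Chain → Chain
  _⊞_ = zipWith _xor_

  ∂ : Chain → Chain
  ∂ c = tabulate λ i → ∑₂ λ j → ⌊ isFacet? i j ⌋ ∧ lookup c j

  Cycle : ℕ → Chain → Set
  Cycle r z = OfDim r z × ∂ z ≡ ∅

  Bounding : ℕ → Chain → Set
  Bounding r z = ∃[ b ] (OfDim (suc r) b × ∂ b ≡ z)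

  Homologous : ℕ → Chain → Chain → Set
  Homologous r z z′ = Bounding r (z ⊞ z′)

  HasseNeighbours : Fin n → Subset n
  HasseNeighbours i = tabulate λ j → ⌊ isFacet? i j ⌋ ∨ ⌊ isFacet? j i ⌋

  Δ : ℕ
  Δ = max 0 (map (λ i → ∣ HasseNeighbours i ∣) (allFin n))

------------------------------------------------------------------------
-- Topological Hitting Set

record THSInstance : Set where
  field
    K           : Complex
    k r         : ℕ
  open Complex K public
  field
    r<d         : r < dimension
    ζ           : Chain
    cycle       : Cycle r ζ
    nonBounding : ¬ Bounding r ζ

  HittingSet : Subset n → Set
  HittingSet S =
    OfDim r S × (∀ z → Cycle r z → Homologous r z ζ → Nonempty (S ∩ z))

  MinimumHittingSet : Subset n → Set
  MinimumHittingSet S = HittingSet S × (∀ T → HittingSet T → ∣ S ∣ ≤ ∣ T ∣)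

bits : ∀ {m} → Subset m → List ℕ
bits s = map (λ b → if b then 1 else 0) (toList s)

-- A complex is presented by the characteristic vectors of its simplices.
encodeTHS : THSInstance → List ℕ
encodeTHS I =
  n ∷ vertices ∷ k ∷ r ∷ bits ζ ++ concatMap (λ i → bits (simplex i)) (allFin n)
  where open THSInstance I

data THSAnswer (I : THSInstance) : List ℕ → Set where

  no  : let open THSInstance I in
        ¬ (∃[ S ] (HittingSet S × ∣ S ∣ ≤ k)) → THSAnswer I (0 ∷ [])

  yes : let open THSInstance I in
        ∀ S → MinimumHittingSet S → ∣ S ∣ ≤ k → THSAnswer I (1 ∷ bits S)

TopologicalHittingSet : Problem
TopologicalHittingSet = record
  { Instance = THSInstance
  ; encode   = encodeTHS
  ; Answer   = THSAnswer
  }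

module Submission where

-- Why a short list of sets contains the optimum.  Call a set η of r-simplices a
-- cocycle when every (r+1)-simplex has an even number of facets in η, and odd
-- when it meets ζ in an odd number of simplices.  An odd cocycle pairs to 1 with
-- every cycle homologous to ζ, so it meets all of them (cocycle-hits).
-- Conversely, if S is a hitting set then ζ restricted to S is not a sum of
-- boundaries restricted to S, as otherwise some ζ + ∂b would avoid S; this uses
-- ∂∂ = 0.  The Fredholm alternative over the field with two elements (fredholm)
-- turns this into an odd cocycle contained in S (hitting-contains).  Therefore
-- the minimum hitting sets are the smallest odd cocycles.
--
-- Why such a cocycle is found.  Let η be a smallest odd cocycle, of size at most
-- k, and let S be a non-empty subset of η.  If S is itself a cocycle then S = η,
-- because S or η + S would be a smaller odd cocycle (closed-part).  Otherwise
-- some (r+1)-simplex has an odd number of facets in S, and, its number of facets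
-- in η being even, one of its facets lies in η but not in S.  So, starting from
-- some s in ζ and k ∸ 1 times adding the right facet of an (r+1)-simplex with an
-- odd number of facets in the current set, one arrives at η (complete).  An
-- (r+1)-simplex has at most B ≤ Δ facets, and the choices form a word of length
-- k ∸ 1 over B letters, that is, the base-B digits of a number below
-- B ^ (k ∸ 1).  The algorithm runs through all s and all such numbers, keeping
-- the smallest odd cocycle of size at most k that appears.
--
-- Why this is fast.  Testing and extending a set takes O(n²) steps once the
-- facet relation is tabulated, which takes O(n³).  With N = (kΔ) ^ k, the number
-- of words, the length of a word and the time to extract a digit are all O(N),
-- so the time is O(n³ · N³).  This is below n ^ (6 + ω) times (kΔ) ^ (3k), with
-- no need of any lower bound on ω.
--
-- The program is verified with a small Hoare logic (Exec) which also bounds the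
-- number of steps, by a constant depending on the program text (weight) times a
-- budget that grows with the nesting of loops; exec-for is its main rule.

open import Defs
open import Algebra.Bundles using (CommutativeRing)
open import Data.Bool using (Bool; true; false; if_then_else_; _∧_; _∨_; _xor_; T)
import Data.Bool.Properties as Boolₚ
open import Data.Bool.Properties using (xor-∧-commutativeRing)
open import Algebra.Properties.CommutativeMonoid.Sum (CommutativeRing.+-commutativeMonoid xor-∧-commutativeRing)
  using (sum-cong-≗; ∑-distrib-+; ∑-comm; sum-replicate-zero)
open import Algebra.Properties.Semiring.Sum (CommutativeRing.semiring xor-∧-commutativeRing)
  using (*-distribˡ-sum; *-distribʳ-sum)
open import Data.Empty using (⊥-elim)
open import Data.Fin using (Fin; toℕ; fromℕ<; zero; suc)
import Data.Fin.Properties as Finₚ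
open import Data.Fin.Properties using (toℕ<n; toℕ-injective)
open import Data.Fin.Subset using (Subset; ∣_∣; _∈_; _∉_; _⊆_; Nonempty; ⁅_⁆; _∩_; _∪_; _-_)
open import Data.Fin.Subset.Properties
  using ( _∈?_; ⊆-antisym; p⊂q⇒∣p∣<∣q∣; p⊆q⇒∣p∣≤∣q∣; x∈⁅x⁆; x∈⁅y⁆⇒x≡y; p⊆p∪q; q⊆p∪q; x∈p∪q⁻; x∈p∩q⁺; x∈p∩q⁻
        ; p∩q⊆q; ∣⁅x⁆∣≡1; ∣p∣≤n; p─⊥≡p; p─q⊆p; anySubset? )
open import Data.List using (List; []; _∷_; _++_; length; map; concatMap; allFin)
import Data.List as List
open import Data.List.Extrema.Nat using (max≤v⁺; xs≤max)
open import Data.List.Properties using (length-++)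
import Data.List.Relation.Unary.All.Properties as Allₚ
open import Data.Nat hiding (parity; ∣_-_∣)
open import Data.Nat.Properties
open import Data.Product using (Σ; ∃; ∃-syntax; _×_; _,_; proj₁; proj₂)
open import Data.Sum using (_⊎_; inj₁; inj₂; [_,_]′)
open import Data.Vec using (Vec; []; _∷_; here; there; lookup; tabulate; zipWith; replicate)
open import Data.Vec.Properties
  using (lookup∘tabulate; tabulate∘lookup; tabulate-cong; []=⇒lookup; lookup⇒[]=; lookup-zipWith; lookup-replicate)
open import Function using (_∘_; id)
open import Relation.Binary.Definitions using (tri<; tri≈; tri>)
open import Relation.Binary.PropositionalEquality
open import Relation.Nullary using (¬_; Dec; ¬?; _×-dec_) renaming (yes to holds; no to fails)
open import Relation.Nullary.Decidable using (⌊_⌋)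
open import Relation.Unary using (Decidable)

-- Reasoning about random access machines

-- The cost of executing every instruction of the program text once, guards of
-- loops counted twice: the second evaluation is the one that leaves the loop.
weight : Program → ℕ
weight skip                     = 1
weight (write a e e′)           = 1 + (cost e + cost e′)
weight (P ⨟ Q)                  = weight P + weight Q
weight (if e then P else′ Q)    = 1 + cost e + (weight P + weight Q)
weight (while e loop P)         = 2 * (1 + cost e) + weight P

-- Whether the text of a program contains an assignment to array b.
writes : Program → ℕ → Bool
writes skip                  b = false
writes (write a e e′)        b = a ≡ᵇ b
writes (P ⨟ Q)               b = writes P b ∨ writes Q b
writes (if e then P else′ Q) b = writes P b ∨ writes Q b
writes (while e loop P)      b = writes P b

-- The two memories agree on every array that P does not assign to.
Frame : Program → Memory → Memory → Set
Frame P M M′ = ∀ b → writes P b ≡ false → ∀ j → M′ b j ≡ M b j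

private
  ∨-falseˡ : ∀ x {y} → x ∨ y ≡ false → x ≡ false
  ∨-falseˡ false _ = refl

  ∨-falseʳ : ∀ x {y} → x ∨ y ≡ false → y ≡ false
  ∨-falseʳ false p = p

frame : ∀ {P M M′ t} → ⟨ P , M ⟩⇓⟨ M′ , t ⟩ → Frame P M M′
frame ⇓skip b _ j = refl
frame ⇓write b p j rewrite p = refl
frame (⇓seq {P = P} u v) b p j =
  trans (frame v b (∨-falseʳ (writes P b) p) j) (frame u b (∨-falseˡ (writes P b) p) j)
frame (⇓then {P = P} _ u) b p j = frame u b (∨-falseˡ (writes P b) p) j
frame (⇓else {P = P} _ u) b p j = frame u b (∨-falseʳ (writes P b) p) j
frame (⇓done _) b p j = refl
frame (⇓loop _ u v) b p j = trans (frame v b p j) (frame u b p j)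

-- Started on M, the program P halts in a memory satisfying Q, after at most
-- weight P * X steps.
record Exec (X : ℕ) (P : Program) (M : Memory) (Q : Memory → Set) : Set where
  constructor exec
  field
    {final} : Memory
    {steps} : ℕ
    halts   : ⟨ P , M ⟩⇓⟨ final , steps ⟩
    fast    : steps ≤ weight P * X
    post    : Q final

conseq : ∀ {X P M Q R} → Exec X P M Q → (∀ M′ → Frame P M M′ → Q M′ → R M′) → Exec X P M R
conseq (exec h f q) g = exec h f (g _ (frame h) q)

slower : ∀ {X Y P M Q} → X ≤ Y → Exec X P M Q → Exec Y P M Q
slower {P = P} X≤Y (exec h f q) = exec h (≤-trans f (*-monoʳ-≤ (weight P) X≤Y)) q

private
  c≤c*X : ∀ {X} c → 1 ≤ X → c ≤ c * X
  c≤c*X c 1≤X = ≤-trans (≤-reflexive (sym (*-identityʳ c))) (*-monoʳ-≤ c 1≤X)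

exec-skip : ∀ {X M} {Q : Memory → Set} → 1 ≤ X → Q M → Exec X skip M Q
exec-skip 1≤X q = exec ⇓skip (c≤c*X 1 1≤X) q

exec-write : ∀ {X a e e′ M} {Q : Memory → Set} → 1 ≤ X →
  Q (update M a (⟦ e ⟧ M) (⟦ e′ ⟧ M)) → Exec X (write a e e′) M Q
exec-write {e = e} {e′} 1≤X q = exec ⇓write (c≤c*X (1 + (cost e + cost e′)) 1≤X) q

exec-seq : ∀ {X P P′ M} {Q : Memory → Set} →
  Exec X P M (λ M′ → Exec X P′ M′ Q) → Exec X (P ⨟ P′) M Q
exec-seq {X} {P} {P′} (exec h f (exec h′ f′ q)) = exec (⇓seq h h′)
  (≤-trans (+-mono-≤ f f′) (≤-reflexive (sym (*-distribʳ-+ X (weight P) (weight P′))))) q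

then-exec : ∀ {X P P′ M} {Q R : Memory → Set} → Exec X P M R →
  (∀ M′ → Frame P M M′ → R M′ → Exec X P′ M′ Q) → Exec X (P ⨟ P′) M Q
then-exec u v = exec-seq (conseq u v)

write-then : ∀ {X a e e′ P M} {Q : Memory → Set} → 1 ≤ X →
  Exec X P (update M a (⟦ e ⟧ M) (⟦ e′ ⟧ M)) Q → Exec X (write a e e′ ⨟ P) M Q
write-then 1≤X u = exec-seq (exec-write 1≤X u)

exec-if : ∀ {X e P P′ M} {Q : Memory → Set} → 1 ≤ X →
  (∀ x → ⟦ e ⟧ M ≡ suc x → Exec X P M Q) →
  (⟦ e ⟧ M ≡ 0 → Exec X P′ M Q) →
  Exec X (if e then P else′ P′) M Q
exec-if {X} {e} {P} {P′} {M} {Q} 1≤X u v = go (⟦ e ⟧ M) refl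
  where
  guard-cost : 1 + cost e ≤ (1 + cost e) * X
  guard-cost = c≤c*X (1 + cost e) 1≤X

  bound : ∀ {t} w → t ≤ w * X → w ≤ weight P + weight P′ →
    1 + (cost e + t) ≤ weight (if e then P else′ P′) * X
  bound {t} w f w≤ = begin
    (1 + cost e) + t                              ≤⟨ +-mono-≤ guard-cost (≤-trans f (*-monoˡ-≤ X w≤)) ⟩
    (1 + cost e) * X + (weight P + weight P′) * X ≡⟨ *-distribʳ-+ X (1 + cost e) (weight P + weight P′) ⟨
    weight (if e then P else′ P′) * X             ∎
    where open ≤-Reasoning

  go : ∀ y → ⟦ e ⟧ M ≡ y → Exec X (if e then P else′ P′) M Q
  go zero    eq with v eq
  ... | exec h f q = exec (⇓else eq h) (bound (weight P′) f (m≤n+m _ _)) q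
  go (suc x) eq with u x eq
  ... | exec h f q = exec (⇓then eq h) (bound (weight P) f (m≤m+n _ _)) q

-- A register is cell 0 of an array of its own, so that Frame applies to it.
reg : ℕ → Expr
reg a = read a (lit 0)

infix 5 _≔_
_≔_ : ℕ → Expr → Program
a ≔ e = write a (lit 0) e

-- Register c runs from 0 up to, and excluding, the number in cell j of array b.
for : (c b j : ℕ) → Program → Program
for c b j P = (c ≔ lit 0) ⨟ (while read b (lit j) ⊖ reg c loop (P ⨟ (c ≔ lit 1 ⊕ reg c)))

≡ᵇ-refl : ∀ a → (a ≡ᵇ a) ≡ true
≡ᵇ-refl zero    = refl
≡ᵇ-refl (suc a) = ≡ᵇ-refl a

update-same : ∀ M a i x → update M a i x a i ≡ x
update-same M a i x rewrite ≡ᵇ-refl a | ≡ᵇ-refl i = refl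

update-other : ∀ M a {i j} x → i ≢ j → update M a i x a j ≡ M a j
update-other M a {i} {j} x i≢j with (a ≡ᵇ a) | i ≡ᵇ j in eq
... | false | _     = refl
... | true  | false = refl
... | true  | true  = ⊥-elim (i≢j (≡ᵇ⇒≡ i j (subst T (sym eq) _)))

private
  ≢-update : ∀ M a i x b j → (a ≡ᵇ b) ≡ false → update M a i x b j ≡ M b j
  ≢-update M a i x b j p rewrite p = refl

-- The invariant may assume that everything the loop does not assign to is
-- unchanged, and is to be restored for the counter value suc i after the body
-- has been executed with counter value i.  If the body has budget X then m
-- rounds have budget m * X.
exec-for : ∀ {X Y c b j P M} {Q : Memory → Set} (m : ℕ) (Inv : ℕ → Memory → Set) →
  1 ≤ X → X ≤ Y → m * X ≤ Y →
  writes P c ≡ false → writes P b ≡ false → (c ≡ᵇ b) ≡ false →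
  M b j ≡ m →
  Inv 0 (update M c 0 0) →
  (∀ i M′ → i < m → M′ c 0 ≡ i → Frame (for c b j P) M M′ → Inv i M′ →
    Exec X P M′ (λ M″ → Inv (suc i) (update M″ c 0 (suc i)))) →
  (∀ M′ → Frame (for c b j P) M M′ → Inv m M′ → Q M′) →
  Exec Y (for c b j P) M Q
exec-for {X} {Y} {c} {b} {j} {P} {M} {Q} m Inv 1≤X X≤Y mX≤Y Pc Pb cb Mb init body end =
  finish (iterate m 0 (update M c 0 0) (+-identityʳ m) (update-same M c 0 0) (λ b′ p j′ → ≢-update M c 0 0 b′ j′ (∨-falseˡ (c ≡ᵇ b′) p)) init)
  where
  guard : Expr
  guard = read b (lit j) ⊖ reg c

  round : Program
  round = P ⨟ (c ≔ lit 1 ⊕ reg c)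

  w : ℕ
  w = weight P

  Fr : Memory → Set
  Fr M′ = Frame (for c b j P) M M′

  Result : ℕ → Memory → Set
  Result l M₁ = ∃[ M₂ ] ∃[ t ] ⟨ while guard loop round , M₁ ⟩⇓⟨ M₂ , t ⟩ × t ≤ 6 + l * ((12 + w) * X) × Fr M₂ × Inv m M₂

  bM : ∀ {M′} → Fr M′ → M′ b j ≡ m
  bM fr = trans (fr b (cong₂ _∨_ cb (cong₂ _∨_ Pb cb)) j) Mb

  iterate : ∀ l i M₁ → l + i ≡ m → M₁ c 0 ≡ i → Fr M₁ → Inv i M₁ → Result l M₁
  iterate zero i M₁ refl ci fr inv = M₁ , 6 , ⇓done g0 , ≤-refl , fr , inv
    where
    g0 : ⟦ guard ⟧ M₁ ≡ 0
    g0 = trans (cong₂ _∸_ (bM fr) ci) (n∸n≡0 i)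
  iterate (suc l) i M₁ eq ci fr inv
    with exec {M₂} {t} h f inv₂ ← body i M₁ (≤-trans (s≤s (m≤n+m i l)) (≤-reflexive eq)) ci fr inv
    = step
    where
    M₃ : Memory
    M₃ = update M₂ c 0 (suc (M₂ c 0))
    c₂ : M₂ c 0 ≡ i
    c₂ = trans (frame h c Pc 0) ci
    fr₂ : Fr M₂
    fr₂ b′ p j′ = trans (frame h b′ (∨-falseˡ (writes P b′) (∨-falseʳ (c ≡ᵇ b′) p)) j′) (fr b′ p j′)
    fr₃ : Fr M₃
    fr₃ b′ p j′ = trans (≢-update M₂ c 0 _ b′ j′ (∨-falseˡ (c ≡ᵇ b′) p)) (fr₂ b′ p j′)
    inv₃ : Inv (suc i) M₃
    inv₃ = subst (λ z → Inv (suc i) (update M₂ c 0 (suc z))) (sym c₂) inv₂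
    g1 : ⟦ guard ⟧ M₁ ≡ suc l
    g1 = trans (cong₂ _∸_ (trans (bM fr) (sym eq)) ci) (m+n∸n≡m (suc l) i)
    bound : ∀ {t′} → t′ ≤ 6 + l * ((12 + w) * X) →
      1 + (5 + ((t + 6) + t′)) ≤ 6 + suc l * ((12 + w) * X)
    bound {t′} f′ = +-monoʳ-≤ 6 (begin
      (t + 6) + t′                                ≤⟨ +-mono-≤ (+-monoˡ-≤ 6 f) f′ ⟩
      (w * X + 6) + (6 + l * ((12 + w) * X))      ≡⟨ +-assoc (w * X + 6) 6 _ ⟨
      (w * X + 6) + 6 + l * ((12 + w) * X)        ≡⟨ cong (_+ l * ((12 + w) * X)) (trans (+-assoc (w * X) 6 6) (+-comm (w * X) 12)) ⟩
      12 + w * X + l * ((12 + w) * X)             ≤⟨ +-monoˡ-≤ _ (+-monoˡ-≤ (w * X) (c≤c*X 12 1≤X)) ⟩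
      12 * X + w * X + l * ((12 + w) * X)         ≡⟨ cong (_+ l * ((12 + w) * X)) (*-distribʳ-+ X 12 w) ⟨
      suc l * ((12 + w) * X)                      ∎)
      where open ≤-Reasoning
    step : Result (suc l) M₁
    step with iterate l (suc i) M₃ (trans (+-suc l i) eq) (trans (update-same M₂ c 0 _) (cong suc c₂)) fr₃ inv₃
    ... | M₄ , t₄ , h₄ , f₄ , fr₄ , inv₄ =
      M₄ , _ , ⇓loop g1 (⇓seq h ⇓write) h₄ , bound f₄ , fr₄ , inv₄

  total : ∀ {t} → t ≤ 6 + m * ((12 + w) * X) → 3 + t ≤ weight (for c b j P) * Y
  total {t} f = begin
    3 + t                            ≤⟨ +-monoʳ-≤ 3 f ⟩
    9 + m * ((12 + w) * X)           ≡⟨ cong (9 +_) (trans (sym (*-assoc m (12 + w) X)) (trans (cong (_* X) (*-comm m (12 + w))) (*-assoc (12 + w) m X))) ⟩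
    9 + (12 + w) * (m * X)           ≤⟨ +-mono-≤ (c≤c*X 9 (≤-trans 1≤X X≤Y)) (*-monoʳ-≤ (12 + w) mX≤Y) ⟩
    9 * Y + (12 + w) * Y             ≡⟨ *-distribʳ-+ Y 9 (12 + w) ⟨
    (21 + w) * Y                     ≡⟨ cong (λ z → (15 + z) * Y) (+-comm 6 w) ⟩
    weight (for c b j P) * Y         ∎
    where open ≤-Reasoning

  finish : Result m (update M c 0 0) → Exec Y (for c b j P) M Q
  finish (M₂ , t , h , f , fr , inv) = exec (⇓seq ⇓write h) (total f) (end M₂ fr inv)

-- The search as a mathematical function

-- Subsets of a finite set are read at arbitrary natural numbers, as the program
-- does with memory; outside the range the value is a default.

bit : Bool → ℕ
bit b = if b then 1 else 0

at : {A : Set} {m : ℕ} → A → Vec A m → ℕ → A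
at d []       i       = d
at d (x ∷ xs) zero    = x
at d (x ∷ xs) (suc i) = at d xs i

infix 9 _‼_
_‼_ : ∀ {m} → Subset m → ℕ → Bool
p ‼ i = at false p i

-- The subset of Fin m cut out by a function on ℕ.
upto : ∀ m → (ℕ → Bool) → Subset m
upto m f = tabulate (f ∘ toℕ)

at-lookup : ∀ {A : Set} {m} d (xs : Vec A m) i → at d xs (toℕ i) ≡ lookup xs i
at-lookup d (x ∷ xs) zero    = refl
at-lookup d (x ∷ xs) (suc i) = at-lookup d xs i

upto-at : ∀ {m} f {i} → i < m → upto m f ‼ i ≡ f i
upto-at {suc m} f {zero}  i<m = refl
upto-at {suc m} f {suc i} (s≤s i<m) = upto-at (f ∘ suc) i<m

sumTo : ℕ → (ℕ → ℕ) → ℕ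
sumTo zero    f = 0
sumTo (suc i) f = f i + sumTo i f

xorTo : ℕ → (ℕ → Bool) → Bool
xorTo zero    f = false
xorTo (suc i) f = xorTo i f xor f i

-- Sums from 0 to m ∸ 1 as a loop computes them; size and parity agree with the
-- cardinality and the inner product, see size≡∣∣ and parity≡· below.
size : ∀ {m} → Subset m → ℕ
size {m} p = sumTo m (bit ∘ (p ‼_))

parity : ∀ {m} → Subset m → Subset m → Bool
parity {m} p q = xorTo m (λ i → p ‼ i ∧ q ‼ i)

-- The number of elements of R below i.
rank : ∀ {m} → Subset m → ℕ → ℕ
rank R i = sumTo i (bit ∘ (R ‼_))

-- Add to S the element of R that has exactly w elements of R below it, if any.
pick : ∀ {m} → Subset m → ℕ → Subset m → Subset m
pick {m} R w S = upto m (λ i → S ‼ i ∨ (R ‼ i ∧ (rank R i ≡ᵇ w)))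

-- Quotient and remainder on division by B, obtained by counting up to q.
digit : ℕ → ℕ → ℕ × ℕ
digit B zero    = 0 , 0
digit B (suc q) with digit B q
... | d , w with B ∸ suc w
...   | zero  = suc d , 0
...   | suc _ = d , suc w

-- The set row (suc t) is the t-th constraint: a set satisfies it when it meets
-- it in an even number of elements.  The set row 0 is a dummy, meant to be
-- empty, that stands for the absence of a violated constraint.
module _ {n : ℕ} (row : ℕ → Subset n) where

  -- The index in row of the last violated one among the first t constraints, or
  -- 0 if there is none.
  violation : ℕ → Subset n → ℕ
  violation zero    S = 0
  violation (suc t) S = if parity (row (suc t)) S then suc t else violation t S

  -- The maximum of 1 and the sizes of the first t constraints.
  branching : ℕ → ℕ
  branching zero    = 1
  branching (suc t) = branching t + (size (row (suc t)) ∸ branching t)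

  -- Add the w-th element of a violated constraint; when no constraint is violated
  -- the dummy row 0 is used and nothing is added.
  grow : Subset n → ℕ → Subset n
  grow S w = pick (row (violation n S)) w S

  -- Grow L times, reading the choices off the base-B digits of q.
  run : (B L q : ℕ) → Subset n → Subset n
  run B zero    q S = S
  run B (suc L) q S = run B L (proj₁ (digit B q)) (grow S (proj₂ (digit B q)))

  -- The set reached from the single element s by the word q of length L.
  candidate : (B L s q : ℕ) → Subset n
  candidate B L s q = run B L q (upto n (s ≡ᵇ_))

-- Programs for one step of the search

-- Exclusive or, conjunction and disjunction of bits, and equality of numbers as
-- a bit.  On numbers e ⊽ e′ is the maximum and e ⊻ e′ the distance.
_⊻_ _⊼_ _⊽_ _≗ᴱ_ : Expr → Expr → Expr
e ⊻ e′ = (e ⊖ e′) ⊕ (e′ ⊖ e)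
e ⊼ e′ = (e ⊕ e′) ⊖ lit 1
e ⊽ e′ = e ⊕ (e′ ⊖ e)
e ≗ᴱ e′ = lit 1 ⊖ (e ⊻ e′)

bit-xor : ∀ a b → (bit a ∸ bit b) + (bit b ∸ bit a) ≡ bit (a xor b)
bit-xor false false = refl
bit-xor false true  = refl
bit-xor true  false = refl
bit-xor true  true  = refl

bit-and : ∀ a b → bit a + bit b ∸ 1 ≡ bit (a ∧ b)
bit-and false false = refl
bit-and false true  = refl
bit-and true  false = refl
bit-and true  true  = refl

bit-or : ∀ a b → bit a + (bit b ∸ bit a) ≡ bit (a ∨ b)
bit-or false false = refl
bit-or false true  = refl
bit-or true  false = refl
bit-or true  true  = refl

bit-≡ᵇ : ∀ a b → 1 ∸ ((a ∸ b) + (b ∸ a)) ≡ bit (a ≡ᵇ b)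
bit-≡ᵇ zero    zero    = refl
bit-≡ᵇ zero    (suc b) = 0∸n≡0 b
bit-≡ᵇ (suc a) zero    = 0∸n≡0 (a + 0)
bit-≡ᵇ (suc a) (suc b) = bit-≡ᵇ a b

-- Arrays 0 and 1 are input and output.  Array aRow holds the matrix of
-- constraints, with row t at addresses t * n onwards, and aSet the current set.
-- The names starting with c are loop counters, those with r other registers:
-- rP runs over the addresses t * n, rOff is the address of a violated row, rQ and
-- rW are the quotient and remainder, rBest and rSize the size of the best set so
-- far and of the current one, rBranch, rLen and rPow the numbers B, L and B ^ L.
aRow aSet cT cI cX rP rT rI rA rB rC rBranch rLen rPow rTmp cS cN cJ rQ rD rW rOff rPar rBest rSize : ℕ
aRow    = 2
aSet    = 3
cT      = 4
cI      = 5
cX      = 6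
rP      = 7
rT      = 8
rI      = 9
rA      = 10
rB      = 11
rC      = 12
rBranch = 13
rLen    = 14
rPow    = 15
rTmp    = 16
cS      = 17
cN      = 18
cJ      = 19
rQ      = 20
rD      = 21
rW      = 22
rOff    = 23
rPar    = 24
rBest   = 25
rSize   = 26

#n : Expr
#n = read 0 (lit 0)

-- Find a violated constraint.  Row 0 lies at address 0, so rOff = 0 means none.
scan : Program
scan =
  (rOff ≔ lit 0) ⨟
  (rP ≔ #n) ⨟
  for cT 0 0 (
    (rPar ≔ lit 0) ⨟
    for cI 0 0 (rPar ≔ reg rPar ⊻ (read aRow (reg cI ⊕ reg rP) ⊼ read aSet (reg cI))) ⨟
    (if reg rPar then rOff ≔ reg rP else′ skip) ⨟
    (rP ≔ #n ⊕ reg rP))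

-- Split rQ into quotient and remainder on division by rBranch.
divide : Program
divide =
  (rD ≔ lit 0) ⨟
  (rW ≔ lit 0) ⨟
  for cX rQ 0 (
    (rW ≔ lit 1 ⊕ reg rW) ⨟
    (if reg rBranch ⊖ reg rW then skip else′ ((rW ≔ lit 0) ⨟ (rD ≔ lit 1 ⊕ reg rD)))) ⨟
  (rQ ≔ reg rD)

-- Replace the current set S by pick R w S, for the row R at address rOff and the
-- number w in rW; rC counts the elements of R seen so far.
extend : Program
extend =
  (rC ≔ lit 0) ⨟
  for cI 0 0 (
    write aSet (reg cI) (read aSet (reg cI) ⊽ (read aRow (reg cI ⊕ reg rOff) ⊼ (reg rC ≗ᴱ reg rW))) ⨟
    (rC ≔ read aRow (reg cI ⊕ reg rOff) ⊕ reg rC))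

-- A loop that fills an array in increasing order has established its goal below
-- the counter and still sees the old values from the counter on.

prefix-write : ∀ {M a i x} (f : ℕ → ℕ) → (∀ j → j < i → M a j ≡ f j) → x ≡ f i →
  ∀ j → j < suc i → update M a i x a j ≡ f j
prefix-write {M} {a} {i} {x} f pre eq j j<1+i with j ≟ i
... | holds refl = trans (update-same M a i x) eq
... | fails j≢i = trans (update-other M a x (j≢i ∘ sym)) (pre j (≤∧≢⇒< (≤-pred j<1+i) j≢i))

suffix-write : ∀ {M a i x} {n : ℕ} (f : ℕ → ℕ) → (∀ j → i ≤ j → j < n → M a j ≡ f j) →
  ∀ j → suc i ≤ j → j < n → update M a i x a j ≡ f j
suffix-write {M} {a} {i} {x} f suf j i<j j<n =
  trans (update-other M a x (<⇒≢ i<j)) (suf j (<⇒≤ i<j) j<n)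

module Verify {n : ℕ} (1≤n : 1 ≤ n) (row : ℕ → Subset n) where

  -- The current set is S.
  Holds : Memory → Subset n → Set
  Holds M S = ∀ i → i < n → M aSet i ≡ bit (S ‼ i)

  -- The matrix of constraints is in place, with the dummy row 0 in front, hence
  -- the bound t ≤ n.
  record Rows (M : Memory) : Set where
    field
      size-cell : M 0 0 ≡ n
      row-cell  : ∀ t i → t ≤ n → i < n → M aRow (i + t * n) ≡ bit (row t ‼ i)
  open Rows

  keep-rows : ∀ {M M′} → (∀ j → M′ 0 j ≡ M 0 j) → (∀ j → M′ aRow j ≡ M aRow j) → Rows M → Rows M′
  keep-rows p q R .size-cell = trans (p 0) (R .size-cell)
  keep-rows p q R .row-cell t i t≤n i<n = trans (q _) (R .row-cell t i t≤n i<n)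

  1≤nn : 1 ≤ n * n
  1≤nn = *-mono-≤ 1≤n 1≤n

  n≤nn : n ≤ n * n
  n≤nn = ≤-trans (≤-reflexive (sym (*-identityʳ n))) (*-monoʳ-≤ n 1≤n)

  n*1≤n : n * 1 ≤ n
  n*1≤n = ≤-reflexive (*-identityʳ n)

  violation≤ : ∀ t S → violation row t S ≤ t
  violation≤ zero S = z≤n
  violation≤ (suc t) S with parity (row (suc t)) S
  ... | true  = ≤-refl
  ... | false = m≤n⇒m≤1+n (violation≤ t S)

  scan-exec : ∀ {M} S → Rows M → Holds M S →
    Exec (n * n) scan M (λ M′ → M′ rOff 0 ≡ violation row n S * n)
  scan-exec {M} S R H =
    write-then 1≤nn (write-then 1≤nn (exec-for n Inv 1≤n n≤nn ≤-refl refl refl refl (R .size-cell)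
      (trans (R .size-cell) (sym (+-identityʳ n)) , refl) body (λ _ _ → proj₂)))
    where
    Inv : ℕ → Memory → Set
    Inv t M′ = M′ rP 0 ≡ suc t * n × M′ rOff 0 ≡ violation row t S * n

    body : ∀ t M₁ → t < n → M₁ cT 0 ≡ t → _ → Inv t M₁ → Exec n _ M₁ _
    body t M₁ t<n ct fr (p , o) = write-then 1≤n (then-exec
      (exec-for n Par ≤-refl 1≤n n*1≤n refl refl refl n₁ refl par (λ _ _ u → u)) λ M₂ fr₂ q →
      exec-seq (exec-if 1≤n
        (λ x eq → exec-write 1≤n (exec-write 1≤n
          ( cong₂ _+_ (trans (fr₂ 0 refl 0) n₁) (trans (fr₂ rP refl 0) p)
          , trans (trans (fr₂ rP refl 0) p)
                  (cong (_* n) (sym (odd (trans (sym q) eq)))))))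
        (λ eq → exec-skip 1≤n (exec-write 1≤n
          ( cong₂ _+_ (trans (fr₂ 0 refl 0) n₁) (trans (fr₂ rP refl 0) p)
          , trans (trans (fr₂ rOff refl 0) o)
                  (cong (_* n) (sym (even (trans (sym q) eq)))))))))
      where
      n₁ : M₁ 0 0 ≡ n
      n₁ = trans (fr 0 refl 0) (R .size-cell)

      Par : ℕ → Memory → Set
      Par i M′ = M′ rPar 0 ≡ bit (xorTo i (λ j → row (suc t) ‼ j ∧ S ‼ j))

      par : ∀ i M₂ → i < n → M₂ cI 0 ≡ i → _ → Par i M₂ → Exec 1 _ M₂ _
      par i M₂ i<n refl fr₂ q = exec-write ≤-refl (trans
        (cong₂ (λ a b → (a ∸ b) + (b ∸ a)) q (trans
          (cong₂ (λ a b → a + b ∸ 1)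
            (trans (cong (λ z → M₂ aRow (i + z)) (trans (fr₂ rP refl 0) p))
              (trans (fr₂ aRow refl _) (trans (fr aRow refl _) (R .row-cell (suc t) i t<n i<n))))
            (trans (fr₂ aSet refl _) (trans (fr aSet refl _) (H i i<n))))
          (bit-and (row (suc t) ‼ i) (S ‼ i))))
        (bit-xor (xorTo i (λ j → row (suc t) ‼ j ∧ S ‼ j)) _))

      odd : ∀ {x} → bit (parity (row (suc t)) S) ≡ suc x → violation row (suc t) S ≡ suc t
      odd eq with parity (row (suc t)) S
      ... | true = refl

      even : bit (parity (row (suc t)) S) ≡ 0 → violation row (suc t) S ≡ violation row t S
      even eq with parity (row (suc t)) S
      ... | false = refl

  divide-exec : ∀ {M X} B q → M rBranch 0 ≡ B → M rQ 0 ≡ q → 1 ≤ X → q ≤ X →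
    Exec X divide M (λ M′ → M′ rQ 0 ≡ proj₁ (digit B q) × M′ rW 0 ≡ proj₂ (digit B q))
  divide-exec {M} {X} B q mB mq 1≤X q≤X =
    write-then 1≤X (write-then 1≤X (then-exec
      (exec-for q Inv ≤-refl 1≤X (≤-trans (≤-reflexive (*-identityʳ q)) q≤X) refl refl refl mq
        (refl , refl) body (λ _ _ u → u))
      (λ M′ fr (d , w) → exec-write 1≤X (d , w))))
    where
    Inv : ℕ → Memory → Set
    Inv x M′ = M′ rD 0 ≡ proj₁ (digit B x) × M′ rW 0 ≡ proj₂ (digit B x)

    body : ∀ x M₁ → x < q → M₁ cX 0 ≡ x → _ → Inv x M₁ → Exec 1 _ M₁ _
    body x M₁ x<q cx fr (d , w) = write-then ≤-refl (exec-if ≤-refl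
      (λ y eq → exec-skip ≤-refl (carry-no (trans (sym guard) eq)))
      (λ eq → write-then ≤-refl (exec-write ≤-refl (carry (trans (sym guard) eq)))))
      where
      guard : M₁ rBranch 0 ∸ suc (M₁ rW 0) ≡ B ∸ suc (proj₂ (digit B x))
      guard = cong₂ (λ a b → a ∸ suc b) (trans (fr rBranch refl 0) mB) w

      carry-no : ∀ {y} → B ∸ suc (proj₂ (digit B x)) ≡ suc y →
        M₁ rD 0 ≡ proj₁ (digit B (suc x)) × suc (M₁ rW 0) ≡ proj₂ (digit B (suc x))
      carry-no eq with digit B x
      ... | d′ , w′ with B ∸ suc w′
      ...   | suc _ = d , cong suc w

      carry : B ∸ suc (proj₂ (digit B x)) ≡ 0 →
        suc (M₁ rD 0) ≡ proj₁ (digit B (suc x)) × 0 ≡ proj₂ (digit B (suc x))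
      carry eq with digit B x
      ... | d′ , w′ with B ∸ suc w′
      ...   | zero = cong suc d , refl

  extend-exec : ∀ {M} S t w → t ≤ n → Rows M → Holds M S → M rOff 0 ≡ t * n → M rW 0 ≡ w →
    Exec n extend M (λ M′ → Holds M′ (pick (row t) w S))
  extend-exec {M} S t w t≤n R H off mw =
    write-then 1≤n (exec-for n Inv ≤-refl 1≤n n*1≤n refl refl refl (R .size-cell)
      ((λ _ ()) , (λ j _ → H j) , refl) body (λ { _ _ (done , _) i i<n → done i i<n }))
    where
    new : ℕ → Bool
    new i = S ‼ i ∨ (row t ‼ i ∧ (rank (row t) i ≡ᵇ w))

    Inv : ℕ → Memory → Set
    Inv i M′ = (∀ j → j < i → M′ aSet j ≡ bit (pick (row t) w S ‼ j))
             × (∀ j → i ≤ j → j < n → M′ aSet j ≡ bit (S ‼ j))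
             × M′ rC 0 ≡ rank (row t) i

    body : ∀ i M₁ → i < n → M₁ cI 0 ≡ i → _ → Inv i M₁ → Exec 1 _ M₁ _
    body i M₁ i<n refl fr (pre , suf , c) = write-then ≤-refl (exec-write ≤-refl
      ( prefix-write {M₁} (λ j → bit (pick (row t) w S ‼ j)) pre (trans (trans
          (cong₂ (λ a b → a + (b ∸ a)) (suf i ≤-refl i<n) (trans
            (cong₂ (λ a b → a + b ∸ 1) cell-eq (trans
              (cong₂ (λ a b → 1 ∸ ((a ∸ b) + (b ∸ a))) c (trans (fr rW refl 0) mw))
              (bit-≡ᵇ (rank (row t) i) w)))
            (bit-and (row t ‼ i) _)))
          (bit-or (S ‼ i) _))
          (cong bit (sym (upto-at new i<n))))
      , suffix-write {M₁} (λ j → bit (S ‼ j)) suf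
      , cong₂ _+_ cell-eq c))
      where
      cell-eq : M₁ aRow (i + M₁ rOff 0) ≡ bit (row t ‼ i)
      cell-eq = trans (cong (λ z → M₁ aRow (i + z)) (trans (fr rOff refl 0) off))
        (trans (fr aRow refl _) (R .row-cell t i t≤n i<n))

-- The enumeration of all choices

-- The characteristic vector of ζ follows the four numbers n, vertices, k, r.
#ζ : Expr → Expr
#ζ e = read 0 (lit 4 ⊕ e)

initialise : Program
initialise = for cI 0 0 (write aSet (reg cI) (reg cS ≗ᴱ reg cI))

-- The parity of the intersection with ζ, and the size of the current set.
measure : Program
measure =
  (rPar ≔ lit 0) ⨟
  (rSize ≔ lit 0) ⨟
  for cI 0 0 (
    (rPar ≔ reg rPar ⊻ (#ζ (reg cI) ⊼ read aSet (reg cI))) ⨟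
    (rSize ≔ read aSet (reg cI) ⊕ reg rSize))

-- Make the current set the output.
save : Program
save =
  write 1 (lit 0) (lit 1) ⨟
  (rBest ≔ reg rSize) ⨟
  for cI 0 0 (write 1 (lit 1 ⊕ reg cI) (read aSet (reg cI)))

steps : Program
steps = for cJ rLen 0 (scan ⨟ divide ⨟ extend)

-- Compute the candidate with start cS and word cN, and save it if it satisfies
-- all constraints, is odd and is smaller than the best set so far.
trial : Program
trial =
  initialise ⨟
  (rQ ≔ reg cN) ⨟
  steps ⨟
  scan ⨟
  measure ⨟
  (if reg rOff then skip else′
  (if reg rPar then
  (if reg rBest ⊖ reg rSize then save else′ skip) else′ skip))

trials : Program
trials = for cN rPow 0 trial

search : Program
search = for cS 0 0 (if #ζ (reg cS) then trials else′ skip)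

digit≤ : ∀ B q → proj₁ (digit B q) ≤ q
digit≤ B zero = z≤n
digit≤ B (suc q) with digit B q | digit≤ B q
... | d , w | d≤q with B ∸ suc w
...   | zero  = s≤s d≤q
...   | suc _ = m≤n⇒m≤1+n d≤q

-- The number K is the common bound on the length L of words, their number P,
-- and the time for division.
module VerifySearch {n : ℕ} (1≤n : 1 ≤ n) (row : ℕ → Subset n) (ζ : Subset n)
                    (B L P k K : ℕ) (1≤K : 1 ≤ K) (L≤K : L ≤ K) (P≤K : P ≤ K) where

  open Verify 1≤n row

  -- What the search reads and never changes.
  record Static (M : Memory) : Set where
    field
      rows   : Rows M
      ζ-cell : ∀ i → i < n → M 0 (4 + i) ≡ bit (ζ ‼ i)
      B-cell : M rBranch 0 ≡ B
      L-cell : M rLen 0 ≡ L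
  open Static
  open Rows

  transport : ∀ {M M′} →
    (∀ j → M′ 0 j ≡ M 0 j) → (∀ j → M′ aRow j ≡ M aRow j) →
    (∀ j → M′ rBranch j ≡ M rBranch j) → (∀ j → M′ rLen j ≡ M rLen j) → Static M → Static M′
  transport p q u v st = record
    { rows   = keep-rows p q (st .rows)
    ; ζ-cell = λ i i<n → trans (p _) (st .ζ-cell i i<n)
    ; B-cell = trans (u 0) (st .B-cell)
    ; L-cell = trans (v 0) (st .L-cell)
    }

  keep : ∀ Q {M M′} → Frame Q M M′ →
    writes Q 0 ≡ false → writes Q aRow ≡ false → writes Q rBranch ≡ false → writes Q rLen ≡ false →
    Static M → Static M′
  keep Q fr p q u v = transport (fr 0 p) (fr aRow q) (fr rBranch u) (fr rLen v)

  -- What a trial tests: no constraint is violated, and the intersection with ζ is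
  -- odd.
  Accepted : Subset n → Set
  Accepted S = violation row n S ≡ 0 × parity ζ S ≡ true

  -- The budgets for one step, a word, all words, and all starting points.
  X₁ X₂ X₃ X₄ : ℕ
  X₁ = K * (n * n)
  X₂ = K * X₁
  X₃ = K * X₂
  X₄ = n * X₃

  K*-grows : ∀ X → X ≤ K * X
  K*-grows X = ≤-trans (≤-reflexive (sym (*-identityˡ X))) (*-monoˡ-≤ X 1≤K)

  1≤X₁ : 1 ≤ X₁
  1≤X₁ = *-mono-≤ 1≤K 1≤nn
  1≤X₂ : 1 ≤ X₂
  1≤X₂ = *-mono-≤ 1≤K 1≤X₁
  1≤X₃ : 1 ≤ X₃
  1≤X₃ = *-mono-≤ 1≤K 1≤X₂
  nn≤X₂ : n * n ≤ X₂
  nn≤X₂ = ≤-trans (K*-grows _) (K*-grows _)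
  n≤X₂ : n ≤ X₂
  n≤X₂ = ≤-trans n≤nn nn≤X₂
  K≤X₁ : K ≤ X₁
  K≤X₁ = ≤-trans (≤-reflexive (sym (*-identityʳ K))) (*-monoʳ-≤ K 1≤nn)

  initialise-exec : ∀ {M} s → Static M → M cS 0 ≡ s →
    Exec n initialise M (λ M′ → Holds M′ (upto n (s ≡ᵇ_)))
  initialise-exec {M} s st ms =
    exec-for n Inv ≤-refl 1≤n n*1≤n refl refl refl (st .rows .size-cell) (λ _ ()) body (λ _ _ u → u)
    where
    Inv : ℕ → Memory → Set
    Inv i M′ = ∀ j → j < i → M′ aSet j ≡ bit (upto n (s ≡ᵇ_) ‼ j)

    body : ∀ i M₁ → i < n → M₁ cI 0 ≡ i → _ → Inv i M₁ → Exec 1 _ M₁ _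
    body i M₁ i<n refl fr pre = exec-write ≤-refl
      (prefix-write {M₁} (λ j → bit (upto n (s ≡ᵇ_) ‼ j)) pre (trans
        (cong (λ z → 1 ∸ ((z ∸ i) + (i ∸ z))) (trans (fr cS refl 0) ms))
        (trans (bit-≡ᵇ s i) (cong bit (sym (upto-at (s ≡ᵇ_) i<n))))))

  measure-exec : ∀ {M} S → Static M → Holds M S →
    Exec n measure M (λ M′ → M′ rPar 0 ≡ bit (parity ζ S) × M′ rSize 0 ≡ size S)
  measure-exec {M} S st H = write-then 1≤n (write-then 1≤n
    (exec-for n Inv ≤-refl 1≤n n*1≤n refl refl refl (st .rows .size-cell) (refl , refl) body (λ _ _ u → u)))
    where
    Inv : ℕ → Memory → Set
    Inv i M′ = M′ rPar 0 ≡ bit (xorTo i (λ j → ζ ‼ j ∧ S ‼ j)) × M′ rSize 0 ≡ sumTo i (bit ∘ (S ‼_))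

    body : ∀ i M₁ → i < n → M₁ cI 0 ≡ i → _ → Inv i M₁ → Exec 1 _ M₁ _
    body i M₁ i<n refl fr (p , z) = write-then ≤-refl (exec-write ≤-refl
      ( trans (cong₂ (λ a b → (a ∸ b) + (b ∸ a)) p (trans
          (cong₂ (λ a b → a + b ∸ 1) (trans (fr 0 refl _) (st .ζ-cell i i<n)) s-cell)
          (bit-and (ζ ‼ i) (S ‼ i))))
        (bit-xor (xorTo i (λ j → ζ ‼ j ∧ S ‼ j)) _)
      , cong₂ _+_ s-cell z))
      where
      s-cell : M₁ aSet i ≡ bit (S ‼ i)
      s-cell = trans (fr aSet refl _) (H i i<n)

  -- The output is the answer S, and its size is recorded.
  Saved : Memory → Subset n → Set
  Saved M S = M rBest 0 ≡ size S × M 1 0 ≡ 1 × (∀ i → i < n → M 1 (suc i) ≡ bit (S ‼ i))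

  save-exec : ∀ {M} S → Static M → Holds M S → M rSize 0 ≡ size S →
    Exec n save M (λ M′ → Saved M′ S)
  save-exec {M} S st H z = write-then 1≤n (write-then 1≤n
    (exec-for n Inv ≤-refl 1≤n n*1≤n refl refl refl (st .rows .size-cell) (refl , λ _ ()) body
      (λ { M′ fr (one , copied) → trans (fr rBest refl 0) z , one , copied })))
    where
    Inv : ℕ → Memory → Set
    Inv i M′ = M′ 1 0 ≡ 1 × (∀ j → j < i → M′ 1 (suc j) ≡ bit (S ‼ j))

    body : ∀ i M₁ → i < n → M₁ cI 0 ≡ i → _ → Inv i M₁ → Exec 1 _ M₁ _
    body i M₁ i<n refl fr (one , copied) = exec-write ≤-refl (one , copied′)
      where
      copied′ : ∀ j → j < suc i → update M₁ 1 (suc i) (M₁ aSet i) 1 (suc j) ≡ bit (S ‼ j)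
      copied′ j j<1+i with j ≟ i
      ... | holds refl = trans (update-same M₁ 1 (suc i) (M₁ aSet i)) (trans (fr aSet refl _) (H i i<n))
      ... | fails j≢i  = trans (update-other M₁ 1 (M₁ aSet i) (j≢i ∘ sym ∘ suc-injective))
        (copied j (≤∧≢⇒< (≤-pred j<1+i) j≢i))

  -- The effect of a trial with candidate S: either nothing is saved, and for good
  -- reason, or S is saved, being acceptable and smaller than the best so far.
  Outcome : Subset n → Memory → Memory → Set
  Outcome S M M′ =
      (M′ rBest 0 ≡ M rBest 0 × M′ 1 0 ≡ M 1 0 × (∀ i → M′ 1 (suc i) ≡ M 1 (suc i)) × (Accepted S → M rBest 0 ≤ size S))
    ⊎ (Accepted S × size S < M rBest 0 × Saved M′ S)

  trial-exec : ∀ {M} s q → Static M → M cS 0 ≡ s → M cN 0 ≡ q → q < P →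
    Exec X₂ trial M (λ M′ → Outcome (candidate row B L s q) M M′)
  trial-exec {M} s N st ms mN N<P =
    then-exec (slower n≤X₂ (initialise-exec s st ms)) λ M₁ fr₁ H₁ →
    write-then 1≤X₂ (then-exec (exec-for L Inv 1≤X₁ (K*-grows _) (*-monoˡ-≤ X₁ L≤K) refl refl refl
      (trans (fr₁ rLen refl 0) (st .L-cell))
      (_ , _ , H₁ , trans (fr₁ cN refl 0) mN , ≤-trans (<⇒≤ N<P) P≤K , refl) (body fr₁) (λ M′ _ → finished M′)) λ M₂ fr₂ H₂ →
    let st₂ = keep steps fr₂ refl refl refl refl (transport (fr₁ 0 refl) (fr₁ aRow refl) (fr₁ rBranch refl) (fr₁ rLen refl) st) in
    then-exec (slower nn≤X₂ (scan-exec S∞ (st₂ .rows) H₂)) λ M₃ fr₃ off →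
    let st₃ = keep scan fr₃ refl refl refl refl st₂
        H₃ : Holds M₃ S∞
        H₃ = λ i i<n → trans (fr₃ aSet refl i) (H₂ i i<n) in
    then-exec (slower n≤X₂ (measure-exec S∞ st₃ H₃)) λ M₄ fr₄ (par , sz) →
    let st₄ = keep measure fr₄ refl refl refl refl st₃
        H₄ : Holds M₄ S∞
        H₄ = λ i i<n → trans (fr₄ aSet refl i) (H₃ i i<n)
        best : M₄ rBest 0 ≡ M rBest 0
        best = trans (fr₄ rBest refl 0) (trans (fr₃ rBest refl 0) (trans (fr₂ rBest refl 0) (fr₁ rBest refl 0)))
        out : ∀ j → M₄ 1 j ≡ M 1 j
        out = λ j → trans (fr₄ 1 refl j) (trans (fr₃ 1 refl j) (trans (fr₂ 1 refl j) (fr₁ 1 refl j)))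
        off₄ : M₄ rOff 0 ≡ violation row n S∞ * n
        off₄ = trans (fr₄ rOff refl 0) off
        rejected : (Accepted S∞ → M rBest 0 ≤ size S∞) → Exec X₂ skip M₄ (Outcome S∞ M)
        rejected = λ f → exec-skip 1≤X₂ (inj₁ (best , out 0 , (λ i → out (suc i)) , f))
    in
    exec-if 1≤X₂
      (λ x eq → rejected λ (v , _) → ⊥-elim (0≢1+n (trans (sym (trans off₄ (cong (_* n) v))) eq)))
      (λ v → exec-if 1≤X₂
        (λ x odd → exec-if 1≤X₂
          (λ y fewer → conseq (slower n≤X₂ (save-exec S∞ st₄ H₄ sz)) (λ M₅ fr₅ saved →
            inj₂ ((zero-row (trans (sym off₄) v) , is-odd (trans (sym par) odd))
                 , smaller (trans (sym (cong₂ _∸_ best sz)) fewer) , saved)))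
          (λ geq → rejected λ _ → m∸n≡0⇒m≤n (trans (sym (cong₂ _∸_ best sz)) geq)))
        (λ even → rejected λ (_ , p) → ⊥-elim (1+n≢0 (trans (sym (trans par (cong bit p))) even)))))
    where
    S∞ : Subset n
    S∞ = candidate row B L s N

    Inv : ℕ → Memory → Set
    Inv j M′ = ∃[ S ] ∃[ q ] (Holds M′ S × M′ rQ 0 ≡ q × q ≤ K × run row B (L ∸ j) q S ≡ S∞)

    body : ∀ {M₁} → Frame initialise M M₁ → ∀ j M₂ → j < L → M₂ cJ 0 ≡ j →
      Frame steps (update M₁ rQ 0 (M₁ cN 0)) M₂ → Inv j M₂ →
      Exec X₁ (scan ⨟ divide ⨟ extend) M₂ (λ M′ → Inv (suc j) (update M′ cJ 0 (suc j)))
    body {M₁} fr₁ j M₂ j<L _ fr₂ (S , q , H , mq , q≤K , eq) =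
      then-exec (slower (K*-grows _) (scan-exec S (st₂ .rows) H)) λ M₃ fr₃ off →
      let st₃ = keep scan fr₃ refl refl refl refl st₂ in
      then-exec (divide-exec B q (st₃ .B-cell) (trans (fr₃ rQ refl 0) mq) 1≤X₁ (≤-trans q≤K K≤X₁)) λ M₄ fr₄ (mq′ , mw) →
      conseq (slower (≤-trans n≤nn (K*-grows _))
        (extend-exec S (violation row n S) (proj₂ (digit B q)) (violation≤ n S)
          (keep divide fr₄ refl refl refl refl st₃ .rows)
          (λ i i<n → trans (fr₄ aSet refl i) (trans (fr₃ aSet refl i) (H i i<n)))
          (trans (fr₄ rOff refl 0) off) mw)) λ M₅ fr₅ H₅ →
      grow row S (proj₂ (digit B q)) , proj₁ (digit B q) , H₅ , trans (fr₅ rQ refl 0) mq′ ,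
      ≤-trans (digit≤ B q) q≤K ,
      trans (sym (cong (λ l → run row B l q S) (+-∸-assoc 1 j<L))) eq
      where
      st₂ : Static M₂
      st₂ = keep steps fr₂ refl refl refl refl (transport (fr₁ 0 refl) (fr₁ aRow refl) (fr₁ rBranch refl) (fr₁ rLen refl) st)

    finished : ∀ M′ → Inv L M′ → Holds M′ S∞
    finished M′ (S , q , H , _ , _ , eq) =
      subst (Holds M′) (trans (sym (cong (λ l → run row B l q S) (n∸n≡0 L))) eq) H

    zero-row : ∀ {v} → v * n ≡ 0 → v ≡ 0
    zero-row {v} eq with m*n≡0⇒m≡0∨n≡0 v eq
    ... | inj₁ v≡0 = v≡0
    ... | inj₂ n≡0 = ⊥-elim (<⇒≢ 1≤n (sym n≡0))

    is-odd : ∀ {b x} → bit b ≡ suc x → b ≡ true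
    is-odd {true} _ = refl

    smaller : ∀ {a b y} → a ∸ b ≡ suc y → b < a
    smaller {a} {b} eq = m∸n≢0⇒n<m (λ e → 0≢1+n (trans (sym e) eq))

  -- Either nothing has been saved yet, or some acceptable candidate of size at
  -- most k is saved.  As rBest starts at suc k, larger ones are never saved.
  Best : Memory → Set
  Best M =
      (M rBest 0 ≡ suc k × M 1 0 ≡ 0)
    ⊎ (∃[ s ] ∃[ q ] (s < n × ζ ‼ s ≡ true × Accepted (candidate row B L s q)
         × size (candidate row B L s q) ≤ k × Saved M (candidate row B L s q)))

  -- The candidate with start s and word q cannot improve on the saved set.
  Done : Memory → ℕ → ℕ → Set
  Done M s q = ζ ‼ s ≡ true → Accepted (candidate row B L s q) → M rBest 0 ≤ size (candidate row B L s q)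

  -- No candidate improves on what is saved.
  Searched : Memory → Set
  Searched M = Best M × (∀ s q → s < n → q < P → Done M s q)

  best≤1+k : ∀ {M} → Best M → M rBest 0 ≤ suc k
  best≤1+k (inj₁ (e , _)) = ≤-reflexive e
  best≤1+k (inj₂ (_ , _ , _ , _ , _ , ≤k , e , _)) = m≤n⇒m≤1+n (≤-trans (≤-reflexive e) ≤k)

  same-best : ∀ {M M′} → M′ rBest 0 ≡ M rBest 0 → M′ 1 0 ≡ M 1 0 → (∀ i → M′ 1 (suc i) ≡ M 1 (suc i)) →
    Best M → Best M′
  same-best p q r (inj₁ (u , v)) = inj₁ (trans p u , trans q v)
  same-best p q r (inj₂ (s , x , a , b , c , d , e , f , g)) =
    inj₂ (s , x , a , b , c , d , trans p e , trans q f , λ i i<n → trans (r i) (g i i<n))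

  step-outcome : ∀ {M M′} s q → s < n → ζ ‼ s ≡ true → Best M → Outcome (candidate row B L s q) M M′ →
    Best M′ × M′ rBest 0 ≤ M rBest 0 × Done M′ s q
  step-outcome {M} {M′} s q s<n ζs best (inj₁ (p , o , o′ , f)) =
    same-best {M} {M′} p o o′ best , ≤-reflexive p , λ _ acc → ≤-trans (≤-reflexive p) (f acc)
  step-outcome {M} {M′} s q s<n ζs best (inj₂ (acc , lt , saved)) =
    inj₂ (s , q , s<n , ζs , acc , ≤-pred (≤-trans lt (best≤1+k {M} best)) , saved) ,
    ≤-trans (≤-reflexive (saved .proj₁)) (<⇒≤ lt) , λ _ _ → ≤-reflexive (saved .proj₁)

  <suc : ∀ {i j} {A : ℕ → Set} → (∀ x → x < i → A x) → A i → j < suc i → A j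
  <suc {i} {j} f a j<1+i with m≤n⇒m<n∨m≡n (≤-pred j<1+i)
  ... | inj₁ j<i  = f j j<i
  ... | inj₂ refl = a

  search-exec : ∀ {M} → Static M → M rPow 0 ≡ P → M rBest 0 ≡ suc k → M 1 0 ≡ 0 →
    Exec X₄ search M Searched
  search-exec {M} st mP mb mo =
    exec-for n Inv 1≤X₃ (≤-trans (≤-reflexive (sym (*-identityˡ X₃))) (*-monoˡ-≤ X₃ 1≤n)) ≤-refl
      refl refl refl (st .rows .size-cell) (inj₁ (mb , mo) , λ _ _ ()) body (λ _ _ u → u)
    where
    Inv : ℕ → Memory → Set
    Inv s M′ = Best M′ × (∀ s′ q → s′ < s → q < P → Done M′ s′ q)

    body : ∀ s M₁ → s < n → M₁ cS 0 ≡ s →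
      Frame search M M₁ → Inv s M₁ → Exec X₃ _ M₁ (λ M′ → Inv (suc s) (update M′ cS 0 (suc s)))
    body s M₁ s<n refl fr (best , done) = exec-if 1≤X₃
      (λ x eq → exec-for P Inner 1≤X₂ (K*-grows _) (*-monoˡ-≤ X₂ P≤K) refl refl refl
        (trans (fr rPow refl 0) mP) (best , done , λ _ ())
        (inner (is-true (trans (sym ζ₁) eq)))
        (λ { M₂ fr₂ (best₂ , done₂ , now) → best₂ ,
             λ s′ q s′<1+s q<P → <suc {A = λ x → Done M₂ x q} (λ x x<s → done₂ x q x<s q<P) (now q q<P) s′<1+s }))
      (λ eq → exec-skip 1≤X₃ (best ,
        λ s′ q s′<1+s q<P → <suc {A = λ x → Done M₁ x q} (λ x x<s → done x q x<s q<P)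
          (λ ζs → ⊥-elim (1+n≢0 (trans (sym (trans ζ₁ (cong bit ζs))) eq))) s′<1+s))
      where
      st₁ : Static M₁
      st₁ = keep search fr refl refl refl refl st

      ζ₁ : M₁ 0 (4 + s) ≡ bit (ζ ‼ s)
      ζ₁ = st₁ .ζ-cell s s<n

      is-true : ∀ {b x} → bit b ≡ suc x → b ≡ true
      is-true {true} _ = refl

      Inner : ℕ → Memory → Set
      Inner q M′ = Best M′ × (∀ s′ q′ → s′ < s → q′ < P → Done M′ s′ q′) × (∀ q′ → q′ < q → Done M′ s q′)

      inner : ζ ‼ s ≡ true → ∀ q M₂ → q < P → M₂ cN 0 ≡ q → Frame trials M₁ M₂ → Inner q M₂ →
        Exec X₂ trial M₂ (λ M′ → Inner (suc q) (update M′ cN 0 (suc q)))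
      inner ζs q M₂ q<P mq fr₂ (best₂ , done₂ , now) =
        conseq (trial-exec s q (keep trials fr₂ refl refl refl refl st₁) (fr₂ cS refl 0) mq q<P)
        λ M₃ fr₃ outcome →
        let (best₃ , fewer , this) = step-outcome {M₂} {M₃} s q s<n ζs best₂ outcome in
        best₃ , (λ s′ q′ a b c d → ≤-trans fewer (done₂ s′ q′ a b c d)) ,
        λ q′ q′<1+q → <suc {A = λ x → Done M₃ s x} (λ x x<q c d → ≤-trans fewer (now x x<q c d)) this q′<1+q

-- Reading the input

#v #k #r : Expr
#v = read 0 (lit 1)
#k = read 0 (lit 2)
#r = read 0 (lit 3)

-- With rA counting the vertices of simplex i outside simplex t, and rB and rC the
-- vertices of these simplices, this is 1 exactly if all three of rA,
-- the distance of rB ⊖ 1 from r, and that of rC ⊖ 1 from r + 1 vanish.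
entry : Expr
entry = lit 1 ⊖ ((reg rA ⊕ ((reg rB ⊖ lit 1) ⊻ #r)) ⊕ ((reg rC ⊖ lit 1) ⊻ (lit 1 ⊕ #r)))

-- Tabulate the constraints.  Row 0 of the matrix is left blank, so rP starts at
-- n; rT and rI are the addresses in the input of simplices t and i.
build : Program
build =
  (rT ≔ lit 4 ⊕ #n) ⨟
  (rP ≔ #n) ⨟
  for cT 0 0 (
    (rI ≔ lit 4 ⊕ #n) ⨟
    for cI 0 0 (
      (rA ≔ lit 0) ⨟
      (rB ≔ lit 0) ⨟
      (rC ≔ lit 0) ⨟
      for cX 0 1 (
        (rA ≔ (read 0 (reg cX ⊕ reg rI) ⊖ read 0 (reg cX ⊕ reg rT)) ⊕ reg rA) ⨟
        (rB ≔ read 0 (reg cX ⊕ reg rI) ⊕ reg rB) ⨟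
        (rC ≔ read 0 (reg cX ⊕ reg rT) ⊕ reg rC)) ⨟
      write aRow (reg rP) entry ⨟
      (rP ≔ lit 1 ⊕ reg rP) ⨟
      (rI ≔ #v ⊕ reg rI)) ⨟
    (rT ≔ #v ⊕ reg rT))

count-branches : Program
count-branches =
  (rBranch ≔ lit 1) ⨟
  (rP ≔ #n) ⨟
  for cT 0 0 (
    (rC ≔ lit 0) ⨟
    for cI 0 0 (rC ≔ read aRow (reg cI ⊕ reg rP) ⊕ reg rC) ⨟
    (rBranch ≔ reg rBranch ⊽ reg rC) ⨟
    (rP ≔ #n ⊕ reg rP))

power : Program
power =
  (rPow ≔ lit 1) ⨟
  for cT rLen 0 (
    (rTmp ≔ lit 0) ⨟
    for cI rBranch 0 (rTmp ≔ reg rPow ⊕ reg rTmp) ⨟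
    (rPow ≔ reg rTmp))

-- The output is 0, meaning that there is no solution, until a set is saved.
main : Program
main =
  (rLen ≔ #k ⊖ lit 1) ⨟
  build ⨟
  count-branches ⨟
  power ⨟
  (rBest ≔ lit 1 ⊕ #k) ⨟
  search

power-exec : ∀ {M Y} B L K → M rBranch 0 ≡ B → M rLen 0 ≡ L → 1 ≤ Y → B ≤ Y → 1 ≤ K → L ≤ K →
  Exec (K * Y) power M (λ M′ → M′ rPow 0 ≡ B ^ L)
power-exec {M} {Y} B L K mB mL 1≤Y B≤Y 1≤K L≤K =
  write-then (*-mono-≤ 1≤K 1≤Y) (exec-for L Inv 1≤Y
    (≤-trans (≤-reflexive (sym (*-identityˡ Y))) (*-monoˡ-≤ Y 1≤K)) (*-monoˡ-≤ Y L≤K)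
    refl refl refl mL refl body (λ _ _ u → u))
  where
  Inv : ℕ → Memory → Set
  Inv j M′ = M′ rPow 0 ≡ B ^ j

  body : ∀ j M₁ → j < L → M₁ cT 0 ≡ j → _ → Inv j M₁ → Exec Y _ M₁ _
  body j M₁ j<L _ fr p = write-then 1≤Y (then-exec
    (exec-for B (λ x M′ → M′ rTmp 0 ≡ x * B ^ j) ≤-refl 1≤Y
      (≤-trans (≤-reflexive (*-identityʳ B)) B≤Y) refl refl refl (trans (fr rBranch refl 0) mB) refl
      (λ x M₂ x<B _ fr₂ q → exec-write ≤-refl (cong₂ _+_ (trans (fr₂ rPow refl 0) p) q))
      (λ _ _ u → u))
    (λ M₃ fr₃ q → exec-write 1≤Y q))

≡ᵇ-0-+ : ∀ a b → (a + b ≡ᵇ 0) ≡ (a ≡ᵇ 0) ∧ (b ≡ᵇ 0)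
≡ᵇ-0-+ zero    b = refl
≡ᵇ-0-+ (suc a) b = refl

≡ᵇ-0-dist : ∀ a b → ((a ∸ b) + (b ∸ a) ≡ᵇ 0) ≡ (a ≡ᵇ b)
≡ᵇ-0-dist zero    zero    = refl
≡ᵇ-0-dist zero    (suc b) = refl
≡ᵇ-0-dist (suc a) zero    = refl
≡ᵇ-0-dist (suc a) (suc b) = ≡ᵇ-0-dist a b

1∸-bit : ∀ a → 1 ∸ a ≡ bit (a ≡ᵇ 0)
1∸-bit zero    = refl
1∸-bit (suc a) = 0∸n≡0 a

address-unique : ∀ {n i i′} t t′ → i < n → i′ < n → i + t * n ≡ i′ + t′ * n → i ≡ i′ × t ≡ t′
address-unique {n} {i} {i′} zero zero i<n i′<n eq =
  trans (sym (+-identityʳ i)) (trans eq (+-identityʳ i′)) , refl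
address-unique {n} {i} {i′} zero (suc t′) i<n i′<n eq = ⊥-elim (<⇒≱ i<n
  (≤-trans (≤-trans (m≤m+n n (t′ * n)) (m≤n+m _ i′)) (≤-reflexive (trans (sym eq) (+-identityʳ i)))))
address-unique {n} {i} {i′} (suc t) zero i<n i′<n eq = ⊥-elim (<⇒≱ i′<n
  (≤-trans (≤-trans (m≤m+n n (t * n)) (m≤n+m _ i)) (≤-reflexive (trans eq (+-identityʳ i′)))))
address-unique {n} {i} {i′} (suc t) (suc t′) i<n i′<n eq
  with address-unique t t′ i<n i′<n (+-cancelˡ-≡ n _ _ (trans (swap i (t * n)) (trans eq (sym (swap i′ (t′ * n))))))
  where
  swap : ∀ a b → n + (a + b) ≡ a + (n + b)
  swap a b = trans (sym (+-assoc n a b)) (trans (cong (_+ b) (+-comm n a)) (+-assoc a n b))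
... | p , q = p , cong suc q

-- The number of elements of p outside q.
excess : ∀ {v} → Subset v → Subset v → ℕ
excess {v} p q = sumTo v (λ x → bit (p ‼ x) ∸ bit (q ‼ x))

-- The simplex p has dimension r and is a facet of the (r+1)-simplex q.
incident : ∀ {v} → ℕ → Subset v → Subset v → Bool
incident r p q = ((excess p q ≡ᵇ 0) ∧ (size p ∸ 1 ≡ᵇ r)) ∧ (size q ∸ 1 ≡ᵇ suc r)

module _ {v : ℕ} (n r : ℕ) (simplexAt : ℕ → Subset v) where

  -- The t-th constraint is the set of facets of the t-th simplex if that has
  -- dimension r + 1, and empty otherwise.
  facet-row : ℕ → Subset n
  facet-row zero    = upto n (λ _ → false)
  facet-row (suc t) = upto n (λ i → incident r (simplexAt i) (simplexAt t))

module VerifyPrep {n v : ℕ} (1≤n : 1 ≤ n) (v≤n : v ≤ n) (r : ℕ) (simplexAt : ℕ → Subset v) where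

  row : ℕ → Subset n
  row = facet-row n r simplexAt

  open Verify 1≤n row
  open Rows

  -- The part of the encoding of an instance from which the constraints are built.
  record Input (M : Memory) : Set where
    field
      n-cell  : M 0 0 ≡ n
      v-cell  : M 0 1 ≡ v
      r-cell  : M 0 3 ≡ r
      simplexAt-cell : ∀ t x → t < n → x < v → M 0 (x + (t * v + (4 + n))) ≡ bit (simplexAt t ‼ x)
  open Input

  keep-input : ∀ {M M′} → (∀ j → M′ 0 j ≡ M 0 j) → Input M → Input M′
  keep-input p I = record
    { n-cell = trans (p _) (I .n-cell) ; v-cell = trans (p _) (I .v-cell)
    ; r-cell = trans (p _) (I .r-cell) ; simplexAt-cell = λ t x a b → trans (p _) (I .simplexAt-cell t x a b) }

  -- The matrix is correct at the addresses below b.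
  Written : ℕ → Memory → Set
  Written b M = ∀ t i → i < n → i + t * n < b → M aRow (i + t * n) ≡ bit (row t ‼ i)

  write-row : ∀ {M x} t i → i < n → Written (i + t * n) M → x ≡ bit (row t ‼ i) →
    Written (suc (i + t * n)) (update M aRow (i + t * n) x)
  write-row {M} {x} t i i<n W eq t′ i′ i′<n lt with i + t * n ≟ i′ + t′ * n
  ... | fails ne = trans (update-other M aRow x ne) (W t′ i′ i′<n (≤∧≢⇒< (≤-pred lt) (ne ∘ sym)))
  ... | holds e with address-unique t t′ i<n i′<n e
  ...   | refl , refl = trans (update-same M aRow (i + t * n) x) eq

  next-address : ∀ {a} t → a ≡ t * v + (4 + n) → v + a ≡ suc t * v + (4 + n)
  next-address t eq = trans (cong (v +_) eq) (sym (+-assoc v (t * v) (4 + n)))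

  build-exec : ∀ {M} → Input M → (∀ i → M aRow i ≡ 0) → Exec (n * (n * n)) build M (λ M′ → Rows M′)
  build-exec {M} I blank = write-then 1≤nnn (write-then 1≤nnn
    (exec-for n Outer 1≤nn (≤-trans (≤-reflexive (sym (*-identityˡ (n * n)))) (*-monoˡ-≤ (n * n) 1≤n)) ≤-refl
      refl refl refl (I .n-cell)
      ( cong (4 +_) (I .n-cell)
      , trans (I .n-cell) (sym (+-identityʳ n))
      , blank-row)
      outer
      (λ M′ fr (_ , _ , W) → record
        { size-cell = trans (fr 0 refl 0) (I .n-cell)
        ; row-cell  = λ t i t≤n i<n → W t i i<n (≤-trans (+-monoˡ-≤ (t * n) i<n) (*-monoˡ-≤ n (s≤s t≤n))) })))
    where
    1≤nnn : 1 ≤ n * (n * n)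
    1≤nnn = *-mono-≤ 1≤n 1≤nn

    blank-row : Written (n + 0) M
    blank-row zero i i<n _ = trans (blank _) (cong bit (sym (upto-at (λ _ → false) i<n)))
    blank-row (suc t) i i<n lt = ⊥-elim (<⇒≱ lt (≤-trans (≤-reflexive (+-identityʳ n))
      (≤-trans (m≤m+n n (t * n)) (m≤n+m _ i))))

    Outer : ℕ → Memory → Set
    Outer t M′ = M′ rT 0 ≡ t * v + (4 + n) × M′ rP 0 ≡ suc t * n × Written (suc t * n) M′

    outer : ∀ t M₁ → t < n → M₁ cT 0 ≡ t → _ → Outer t M₁ → Exec (n * n) _ M₁ _
    outer t M₁ t<n ct fr (mT , mP , W) = write-then 1≤nn (then-exec
      (exec-for n Inner 1≤n n≤nn ≤-refl refl refl refl n₁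
        (cong (4 +_) n₁ , mP , W)
        inner (λ _ _ u → u))
      (λ M₂ fr₂ (_ , mP₂ , W₂) → exec-write 1≤nn
        ( trans (cong (_+ M₂ rT 0) (trans (fr₂ 0 refl 1) (I₁ .v-cell))) (next-address t (trans (fr₂ rT refl 0) mT))
        , mP₂ , W₂)))
      where
      I₁ : Input M₁
      I₁ = keep-input (fr 0 refl) I
      n₁ : M₁ 0 0 ≡ n
      n₁ = I₁ .n-cell

      Inner : ℕ → Memory → Set
      Inner i M′ = M′ rI 0 ≡ i * v + (4 + n) × M′ rP 0 ≡ i + suc t * n × Written (i + suc t * n) M′

      inner : ∀ i M₂ → i < n → M₂ cI 0 ≡ i → _ → Inner i M₂ → Exec n _ M₂ _
      inner i M₂ i<n ci fr₂ (mI , mP₂ , W₂) = write-then 1≤n (write-then 1≤n (write-then 1≤n (then-exec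
        (exec-for v Sums ≤-refl 1≤n (≤-trans (≤-reflexive (*-identityʳ v)) v≤n) refl refl refl (I₂ .v-cell)
          (refl , refl , refl) sums (λ _ _ u → u))
        λ M₃ fr₃ (a , b , c) →
        let value : ⟦ entry ⟧ M₃ ≡ _
            value = cong₂ (λ x y → 1 ∸ (x + y))
              (cong₂ _+_ a (cong₂ (λ x y → (x ∸ 1 ∸ y) + (y ∸ (x ∸ 1))) b (trans (fr₃ 0 refl 3) (I₂ .r-cell))))
              (cong₂ (λ x y → (x ∸ 1 ∸ suc y) + (suc y ∸ (x ∸ 1))) c (trans (fr₃ 0 refl 3) (I₂ .r-cell)))
            mP₃ = trans (fr₃ rP refl 0) mP₂ in
        write-then 1≤n (write-then 1≤n (exec-write 1≤n
          ( trans (cong₂ _+_ (trans (fr₃ 0 refl 1) (I₂ .v-cell)) (fr₃ rI refl 0)) (next-address i mI)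
          , cong suc mP₃
          , subst (λ z → Written (suc (i + suc t * n)) (update M₃ aRow z (⟦ entry ⟧ M₃))) (sym mP₃)
              (write-row {M₃} (suc t) i i<n
                (λ t′ i′ i′<n lt → trans (fr₃ aRow refl _) (W₂ t′ i′ i′<n lt))
                (trans value entry≡)))))))) 
        where
        I₂ : Input M₂
        I₂ = keep-input (λ j → trans (fr₂ 0 refl j) (fr 0 refl j)) I

        p q : Subset v
        p = simplexAt i
        q = simplexAt t

        entry≡ : 1 ∸ ((excess p q + ((size p ∸ 1 ∸ r) + (r ∸ (size p ∸ 1)))) + ((size q ∸ 1 ∸ suc r) + (suc r ∸ (size q ∸ 1))))
              ≡ bit (row (suc t) ‼ i)
        entry≡ = trans (1∸-bit (excess p q + _ + _)) (cong bit (trans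
          (trans (≡ᵇ-0-+ (excess p q + _) _) (cong₂ _∧_
            (trans (≡ᵇ-0-+ (excess p q) _) (cong ((excess p q ≡ᵇ 0) ∧_) (≡ᵇ-0-dist (size p ∸ 1) r)))
            (≡ᵇ-0-dist (size q ∸ 1) (suc r))))
          (sym (upto-at (λ j → incident r (simplexAt j) q) i<n))))

        Sums : ℕ → Memory → Set
        Sums x M′ = M′ rA 0 ≡ sumTo x (λ y → bit (p ‼ y) ∸ bit (q ‼ y))
                  × M′ rB 0 ≡ sumTo x (bit ∘ (p ‼_))
                  × M′ rC 0 ≡ sumTo x (bit ∘ (q ‼_))

        sums : ∀ x M₃ → x < v → M₃ cX 0 ≡ x → _ → Sums x M₃ → Exec 1 _ M₃ _
        sums x M₃ x<v refl fr₃ (a , b , c) = write-then ≤-refl (write-then ≤-refl (exec-write ≤-refl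
          (cong₂ _+_ (cong₂ _∸_ p-cell q-cell) a , cong₂ _+_ p-cell b , cong₂ _+_ q-cell c)))
          where
          p-cell : M₃ 0 (x + M₃ rI 0) ≡ bit (p ‼ x)
          p-cell = trans (cong (λ z → M₃ 0 (x + z)) (trans (fr₃ rI refl 0) mI))
            (trans (fr₃ 0 refl _) (I₂ .simplexAt-cell i x i<n x<v))
          q-cell : M₃ 0 (x + M₃ rT 0) ≡ bit (q ‼ x)
          q-cell = trans (cong (λ z → M₃ 0 (x + z)) (trans (fr₃ rT refl 0) (trans (fr₂ rT refl 0) mT)))
            (trans (fr₃ 0 refl _) (I₂ .simplexAt-cell t x t<n x<v))

  count-exec : ∀ {M} → Rows M → Exec (n * n) count-branches M (λ M′ → M′ rBranch 0 ≡ branching row n)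
  count-exec {M} R = write-then 1≤nn (write-then 1≤nn
    (exec-for n Inv 1≤n n≤nn ≤-refl refl refl refl (R .size-cell)
      (trans (R .size-cell) (sym (+-identityʳ n)) , refl) body (λ _ _ → proj₂)))
    where
    Inv : ℕ → Memory → Set
    Inv t M′ = M′ rP 0 ≡ suc t * n × M′ rBranch 0 ≡ branching row t

    body : ∀ t M₁ → t < n → M₁ cT 0 ≡ t → _ → Inv t M₁ → Exec n _ M₁ _
    body t M₁ t<n ct fr (mP , mB) = write-then 1≤n (then-exec
      (exec-for n (λ i M′ → M′ rC 0 ≡ sumTo i (bit ∘ (row (suc t) ‼_))) ≤-refl 1≤n n*1≤n refl refl refl n₁ refl
        (λ { i M₂ i<n refl fr₂ c → exec-write ≤-refl (cong₂ _+_
          (trans (cong (λ z → M₂ aRow (i + z)) (trans (fr₂ rP refl 0) mP))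
            (trans (fr₂ aRow refl _) (trans (fr aRow refl _) (R .row-cell (suc t) i t<n i<n)))) c) })
        (λ _ _ u → u))
      λ M₃ fr₃ c → write-then 1≤n (exec-write 1≤n
        ( cong₂ _+_ (trans (fr₃ 0 refl 0) n₁) (trans (fr₃ rP refl 0) mP)
        , cong₂ (λ x y → x + (y ∸ x)) (trans (fr₃ rBranch refl 0) mB) c)))
      where
      n₁ : M₁ 0 0 ≡ n
      n₁ = trans (fr 0 refl 0) (R .size-cell)

-- Completeness of the search

true≢false : true ≢ false
true≢false ()

-- The bilinear pairing of chains and cochains, both being sets of simplices.
infix 8 _·_
_·_ : ∀ {m} → Subset m → Subset m → Bool
p · q = ∑₂ (λ i → lookup p i ∧ lookup q i)

infixl 6 _⊕₂_
_⊕₂_ : ∀ {m} → Subset m → Subset m → Subset m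
_⊕₂_ = zipWith _xor_

·-⊕₂ : ∀ {m} (p q q′ : Subset m) → p · (q ⊕₂ q′) ≡ (p · q) xor (p · q′)
·-⊕₂ p q q′ = trans
  (sum-cong-≗ (λ i → trans (cong (lookup p i ∧_) (lookup-zipWith _xor_ i q q′)) (distrib (lookup p i) _ _)))
  (∑-distrib-+ (λ i → lookup p i ∧ lookup q i) (λ i → lookup p i ∧ lookup q′ i))
  where
  distrib : ∀ a b c → a ∧ (b xor c) ≡ (a ∧ b) xor (a ∧ c)
  distrib false b c = refl
  distrib true  b c = refl

∑₂-differ : ∀ {m} (f g : Fin m → Bool) → ∑₂ f ≢ ∑₂ g → ∃[ i ] f i ≢ g i
∑₂-differ {zero}  f g ne = ⊥-elim (ne refl)
∑₂-differ {suc m} f g ne with f zero Boolₚ.≟ g zero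
... | fails f≢g = zero , f≢g
... | holds f≡g with ∑₂-differ (f ∘ suc) (g ∘ suc) (λ e → ne (cong₂ _xor_ f≡g e))
...   | i , f≢g = suc i , f≢g

xorTo-front : ∀ m f → xorTo (suc m) f ≡ f 0 xor xorTo m (f ∘ suc)
xorTo-front zero    f = sym (Boolₚ.xor-identityʳ (f 0))
xorTo-front (suc m) f = trans (cong (_xor f (suc m)) (xorTo-front m f)) (Boolₚ.xor-assoc (f 0) _ _)

∑₂-xorTo : ∀ m f → ∑₂ {m} (f ∘ toℕ) ≡ xorTo m f
∑₂-xorTo zero    f = refl
∑₂-xorTo (suc m) f = trans (cong (f 0 xor_) (∑₂-xorTo m (f ∘ suc))) (sym (xorTo-front m f))

parity≡· : ∀ {m} (p q : Subset m) → parity p q ≡ p · q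
parity≡· {m} p q = trans (sym (∑₂-xorTo m (λ i → p ‼ i ∧ q ‼ i)))
  (sum-cong-≗ (λ i → cong₂ _∧_ (at-lookup false p i) (at-lookup false q i)))

sumTo-front : ∀ m f → sumTo (suc m) f ≡ f 0 + sumTo m (f ∘ suc)
sumTo-front zero    f = refl
sumTo-front (suc m) f = begin
  f (suc m) + sumTo (suc m) f             ≡⟨ cong (f (suc m) +_) (sumTo-front m f) ⟩
  f (suc m) + (f 0 + sumTo m (f ∘ suc))   ≡⟨ +-assoc (f (suc m)) (f 0) _ ⟨
  f (suc m) + f 0 + sumTo m (f ∘ suc)     ≡⟨ cong (_+ sumTo m (f ∘ suc)) (+-comm (f (suc m)) (f 0)) ⟩
  f 0 + f (suc m) + sumTo m (f ∘ suc)     ≡⟨ +-assoc (f 0) (f (suc m)) _ ⟩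
  f 0 + (f (suc m) + sumTo m (f ∘ suc))   ∎
  where open ≡-Reasoning

size≡∣∣ : ∀ {m} (p : Subset m) → size p ≡ ∣ p ∣
size≡∣∣ [] = refl
size≡∣∣ {suc m} (false ∷ p) = trans (sumTo-front m (bit ∘ ((false ∷ p) ‼_))) (size≡∣∣ p)
size≡∣∣ {suc m} (true ∷ p) = trans (sumTo-front m (bit ∘ ((true ∷ p) ‼_))) (cong suc (size≡∣∣ p))

upto-lookup : ∀ {m} (f : ℕ → Bool) (i : Fin m) → lookup (upto m f) i ≡ f (toℕ i)
upto-lookup f i = lookup∘tabulate (f ∘ toℕ) i

upto-≡ : ∀ {m} f (p : Subset m) → (∀ i → f (toℕ i) ≡ lookup p i) → upto m f ≡ p
upto-≡ f p eq = trans (tabulate-cong eq) (tabulate∘lookup p)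

∈⇒true : ∀ {m} {p : Subset m} {i} → i ∈ p → lookup p i ≡ true
∈⇒true = []=⇒lookup

true⇒∈ : ∀ {m} {p : Subset m} {i} → lookup p i ≡ true → i ∈ p
true⇒∈ {p = p} {i} = lookup⇒[]= i p

⊆-large⇒≡ : ∀ {m} {p q : Subset m} → p ⊆ q → ∣ q ∣ ≤ ∣ p ∣ → p ≡ q
⊆-large⇒≡ {p = p} p⊆q q≤p = ⊆-antisym p⊆q q⊆p
  where
  q⊆p : ∀ {x} → x ∈ _ → x ∈ p
  q⊆p {x} x∈q with x ∈? p
  ... | holds x∈p = x∈p
  ... | fails x∉p = ⊥-elim (<⇒≱ (p⊂q⇒∣p∣<∣q∣ (p⊆q , x , x∈q , x∉p)) q≤p)

digit-exact : ∀ B w d → w < B → digit B (w + d * B) ≡ (d , w)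
digit-exact B zero    zero    w<B = refl
digit-exact (suc B) zero (suc d) w<B rewrite digit-exact (suc B) B d ≤-refl | n∸n≡0 B = refl
digit-exact B (suc w) d w<B
  rewrite digit-exact B w d (<⇒≤ w<B) with B ∸ suc w in eq
... | zero  = ⊥-elim (<⇒≱ w<B (m∸n≡0⇒m≤n eq))
... | suc _ = refl

word< : ∀ B P w d → w < B → d < P → w + d * B < B * P
word< B P w d w<B d<P = ≤-trans (+-monoˡ-≤ (d * B) w<B)
  (≤-trans (*-monoˡ-≤ B d<P) (≤-reflexive (*-comm P B)))

sumTo-mono : ∀ f {i j} → i ≤ j → sumTo i f ≤ sumTo j f
sumTo-mono f {j = zero} z≤n = z≤n
sumTo-mono f {i} {suc j} i≤1+j with m≤n⇒m<n∨m≡n i≤1+j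
... | inj₁ i<1+j = ≤-trans (sumTo-mono f (≤-pred i<1+j)) (m≤n+m _ (f j))
... | inj₂ refl  = ≤-refl

rank-< : ∀ {m} (R : Subset m) {i j} → R ‼ i ≡ true → i < j → rank R i < rank R j
rank-< R {i} {j} Ri i<j = ≤-trans (≤-reflexive (cong (λ b → bit b + rank R i) (sym Ri)))
  (sumTo-mono (bit ∘ (R ‼_)) i<j)

rank-injective : ∀ {m} (R : Subset m) i j → R ‼ i ≡ true → R ‼ j ≡ true → rank R i ≡ rank R j → i ≡ j
rank-injective R i j Ri Rj eq with <-cmp i j
... | tri< i<j _ _ = ⊥-elim (<⇒≢ (rank-< R Ri i<j) eq)
... | tri≈ _ i≡j _ = i≡j
... | tri> _ _ j<i = ⊥-elim (<⇒≢ (rank-< R Rj j<i) (sym eq))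

∧-true : ∀ {a b} → a ∧ b ≡ true → a ≡ true × b ≡ true
∧-true {true} {true} _ = refl , refl

module _ {m : ℕ} (R S : Subset m) (i : Fin m) where

  private
    new : ℕ → Bool
    new j = S ‼ j ∨ (R ‼ j ∧ (rank R j ≡ᵇ rank R (toℕ i)))

  pick-old : S ⊆ pick R (rank R (toℕ i)) S
  pick-old {j} j∈S = true⇒∈ (trans (upto-lookup new j)
    (cong (_∨ _) (trans (at-lookup false S j) (∈⇒true j∈S))))

  pick-new : i ∈ R → i ∈ pick R (rank R (toℕ i)) S
  pick-new i∈R = true⇒∈ (trans (upto-lookup new i)
    (trans (cong₂ (λ a b → S ‼ toℕ i ∨ (a ∧ b)) (trans (at-lookup false R i) (∈⇒true i∈R)) (≡ᵇ-refl (rank R (toℕ i))))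
      (Boolₚ.∨-zeroʳ (S ‼ toℕ i))))

  pick-only : i ∈ R → ∀ {j} → j ∈ pick R (rank R (toℕ i)) S → j ∈ S ⊎ j ≡ i
  pick-only i∈R {j} j∈ with S ‼ toℕ j in Sj | trans (sym (upto-lookup new j)) (∈⇒true j∈)
  ... | true  | _ = inj₁ (true⇒∈ (trans (sym (at-lookup false S j)) Sj))
  ... | false | e with ∧-true {R ‼ toℕ j} e
  ...   | Rj , same = inj₂ (toℕ-injective (rank-injective R (toℕ j) (toℕ i) Rj
    (trans (at-lookup false R i) (∈⇒true i∈R)) (≡ᵇ⇒≡ _ _ (subst T (sym same) _))))

module _ {n : ℕ} (row : ℕ → Subset n) where

  violation-sound : ∀ t S → violation row t S ≡ 0 → ∀ u → u < t → row (suc u) · S ≡ false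
  violation-sound (suc t) S eq u u<1+t with parity (row (suc t)) S in par
  ... | false with m≤n⇒m<n∨m≡n (≤-pred u<1+t)
  ...   | inj₁ u<t  = violation-sound t S eq u u<t
  ...   | inj₂ refl = trans (sym (parity≡· (row (suc t)) S)) par

  violation-found : ∀ t S {u} → violation row t S ≡ suc u → u < t × row (suc u) · S ≡ true
  violation-found (suc t) S eq with parity (row (suc t)) S in par
  ... | true  with refl ← eq = ≤-refl , trans (sym (parity≡· (row (suc t)) S)) par
  ... | false with u<t , odd ← violation-found t S eq = m≤n⇒m≤1+n u<t , odd

  violation-none : ∀ t S → (∀ u → u < t → row (suc u) · S ≡ false) → violation row t S ≡ 0
  violation-none t S even with violation row t S in eq
  ... | zero  = refl
  ... | suc u with u<t , odd ← violation-found t S eq with () ← trans (sym odd) (even u u<t)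

  branching-mono : ∀ {t u} → t ≤ u → branching row t ≤ branching row u
  branching-mono {u = zero} z≤n = ≤-refl
  branching-mono {t} {suc u} t≤ with m≤n⇒m<n∨m≡n t≤
  ... | inj₁ t<   = ≤-trans (branching-mono (≤-pred t<)) (m≤m+n _ _)
  ... | inj₂ refl = ≤-refl

  size≤branching : ∀ t → t < n → size (row (suc t)) ≤ branching row n
  size≤branching t t<n = ≤-trans (m≤n+m∸n (size (row (suc t))) (branching row t)) (branching-mono t<n)

  branching≤ : ∀ {D} t → 1 ≤ D → (∀ u → u < t → size (row (suc u)) ≤ D) → branching row t ≤ D
  branching≤ zero    1≤D sizes = 1≤D
  branching≤ (suc t) 1≤D sizes with ≤-total (size (row (suc t))) (branching row t)
  ... | inj₁ s≤b = ≤-trans (≤-reflexive (trans (cong (branching row t +_) (m≤n⇒m∸n≡0 s≤b)) (+-identityʳ _)))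
    (branching≤ t 1≤D (λ u u<t → sizes u (m≤n⇒m≤1+n u<t)))
  ... | inj₂ b≤s = ≤-trans (≤-reflexive (m+[n∸m]≡n b≤s)) (sizes t ≤-refl)

  1≤branching : ∀ t → 1 ≤ branching row t
  1≤branching zero    = ≤-refl
  1≤branching (suc t) = ≤-trans (1≤branching t) (m≤m+n _ _)

  -- All constraints are satisfied; the sets with this property form a vector space.
  Closed : Subset n → Set
  Closed S = ∀ t → t < n → row (suc t) · S ≡ false

  module Completeness (row-0 : ∀ i → lookup (row 0) i ≡ false) (ζ : Subset n) where

    -- An odd cocycle, in terms of the constraints.
    Valid : Subset n → Set
    Valid S = Closed S × ζ · S ≡ true

    -- A smallest odd cocycle.
    Minimal : Subset n → Set
    Minimal η = Valid η × (∀ T → Valid T → ∣ η ∣ ≤ ∣ T ∣)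

    -- One of S and η ⊕₂ S is valid, since their pairings with ζ add up to 1.
    closed-part : ∀ {η S} → Minimal η → S ⊆ η → Nonempty S → Closed S → S ≡ η
    closed-part {η} {S} ((even , odd) , least) S⊆η (x , x∈S) evenS with ζ · S in ζS
    ... | true  = ⊆-large⇒≡ S⊆η (least S (evenS , ζS))
    ... | false = ⊥-elim (<⇒≱ (p⊂q⇒∣p∣<∣q∣ ((λ {y} → rest⊆η {y}) , x , S⊆η x∈S , x∉rest)) (least (η ⊕₂ S) rest-valid))
      where
      rest-valid : Valid (η ⊕₂ S)
      rest-valid = (λ t t<n → trans (·-⊕₂ (row (suc t)) η S) (cong₂ _xor_ (even t t<n) (evenS t t<n)))
                 , trans (·-⊕₂ ζ η S) (cong₂ _xor_ odd ζS)
      rest⊆η : ∀ {y} → y ∈ η ⊕₂ S → y ∈ η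
      rest⊆η {y} y∈ with lookup S y in Sy
      ... | true  = S⊆η (true⇒∈ Sy)
      ... | false = true⇒∈ (trans (sym (Boolₚ.xor-identityʳ _)) (trans (cong (lookup η y xor_) (sym Sy))
        (trans (sym (lookup-zipWith _xor_ y η S)) (∈⇒true y∈))))
      x∉rest : x ∉ η ⊕₂ S
      x∉rest x∈ with () ← trans (sym (∈⇒true x∈)) (trans (lookup-zipWith _xor_ x η S)
        (cong₂ _xor_ (∈⇒true (S⊆η x∈S)) (∈⇒true x∈S)))

    -- The parities of the intersections of R with S and with the larger set η
    -- differ, so R meets η outside S.
    missing : ∀ {R η S : Subset n} → S ⊆ η → R · S ≡ true → R · η ≡ false → ∃[ i ] (i ∈ R × i ∈ η × i ∉ S)
    missing {R} {η} {S} S⊆η odd even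
      with i , ne ← ∑₂-differ (λ i → lookup R i ∧ lookup S i) (λ i → lookup R i ∧ lookup η i)
                      (λ e → true≢false (trans (sym odd) (trans e even)))
      with lookup R i in Ri | lookup S i in Si | lookup η i in ηi
    ... | false | _     | _     = ⊥-elim (ne refl)
    ... | true  | false | false = ⊥-elim (ne refl)
    ... | true  | true  | true  = ⊥-elim (ne refl)
    ... | true  | true  | false with () ← trans (sym (∈⇒true (S⊆η (true⇒∈ Si)))) ηi
    ... | true  | false | true  = i , true⇒∈ Ri , true⇒∈ ηi , λ i∈S → true≢false (trans (sym (∈⇒true i∈S)) Si)

    B : ℕ
    B = branching row n

    grow-closed : ∀ {S} w → Closed S → grow row S w ≡ S
    grow-closed {S} w even rewrite violation-none n S even =
      upto-≡ (λ i → S ‼ i ∨ (row 0 ‼ i ∧ (rank (row 0) i ≡ᵇ w))) S (λ i →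
        trans (cong₂ (λ a b → a ∨ (b ∧ (rank (row 0) (toℕ i) ≡ᵇ w))) (at-lookup false S i) (trans (at-lookup false (row 0) i) (row-0 i)))
        (Boolₚ.∨-identityʳ _))

    run-closed : ∀ {S} L q → Closed S → run row B L q S ≡ S
    run-closed zero    q even = refl
    run-closed (suc L) q even = trans
      (cong (run row B L (proj₁ (digit B q))) (grow-closed (proj₂ (digit B q)) even)) (run-closed L _ even)

    run-word : ∀ L w d S → w < B → run row B (suc L) (w + d * B) S ≡ run row B L d (grow row S w)
    run-word L w d S w<B = cong (λ z → run row B L (proj₁ z) (grow row S (proj₂ z))) (digit-exact B w d w<B)

    -- Each violated constraint has an element of η outside S, and its rank is the
    -- digit to choose; L digits suffice if at most L elements are missing.
    reach : ∀ {η} → Minimal η → ∀ L S → S ⊆ η → Nonempty S → ∣ η ∣ ≤ ∣ S ∣ + L →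
      ∃[ q ] (q < B ^ L × run row B L q S ≡ η)
    reach min zero S S⊆η _ small =
      0 , ≤-refl , ⊆-large⇒≡ S⊆η (≤-trans small (≤-reflexive (+-identityʳ _)))
    reach {η} min (suc L) S S⊆η ne@(x , x∈S) small = go (violation row n S) refl
      where
      go : ∀ v → violation row n S ≡ v → ∃[ q ] (q < B ^ suc L × run row B (suc L) q S ≡ η)
      go zero viol = 0 , m^n>0 B {{>-nonZero (1≤branching n)}} (suc L) ,
        trans (run-closed (suc L) 0 even) (closed-part min S⊆η ne even)
        where
        even : Closed S
        even = violation-sound n S viol
      go (suc u) viol
        with u<n , odd ← violation-found n S viol
        with i , i∈R , i∈η , i∉S ← missing S⊆η odd (min .proj₁ .proj₁ u u<n)
        with d , d< , found ← reach min L (pick (row (suc u)) (rank (row (suc u)) (toℕ i)) S)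
          (λ j∈ → [ S⊆η , (λ { refl → i∈η }) ]′ (pick-only (row (suc u)) S i i∈R j∈))
          (x , pick-old (row (suc u)) S i x∈S)
          (≤-trans small (≤-trans (≤-reflexive (+-suc ∣ S ∣ L)) (+-monoˡ-≤ L (p⊂q⇒∣p∣<∣q∣
            ((λ {y} → pick-old (row (suc u)) S i {y}) , i , pick-new (row (suc u)) S i i∈R , i∉S)))))
        = w + d * B , word< B (B ^ L) w d w<B d< ,
          trans (run-word L w d S w<B) (trans (cong (λ t → run row B L d (pick (row t) w S)) viol) found)
        where
        w : ℕ
        w = rank (row (suc u)) (toℕ i)

        w<B : w < B
        w<B = ≤-trans (rank-< (row (suc u)) (trans (at-lookup false (row (suc u)) i) (∈⇒true i∈R)) (toℕ<n i))
          (size≤branching u u<n)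

    complete : ∀ {η} k → Minimal η → ∣ η ∣ ≤ k →
      ∃[ s ] ∃[ q ] (s < n × q < B ^ (k ∸ 1) × ζ ‼ s ≡ true × candidate row B (k ∸ 1) s q ≡ η)
    complete {η} k min small
      with i , ne ← ∑₂-differ (λ i → lookup ζ i ∧ lookup η i) (λ i → false)
             (λ e → true≢false (trans (sym (min .proj₁ .proj₂)) (trans e (sum-replicate-zero n))))
      with lookup ζ i in ζi | lookup η i in ηi
    ... | false | _     = ⊥-elim (ne refl)
    ... | true  | false = ⊥-elim (ne refl)
    ... | true  | true  =
      let (q , q< , eq) = reach min (k ∸ 1) S S⊆η (i , i∈S) (≤-trans small (≤-trans (k≤ k) (+-monoˡ-≤ (k ∸ 1) 1≤S))) in
      toℕ i , q , toℕ<n i , q< , trans (at-lookup false ζ i) ζi , eq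
      where
      S : Subset n
      S = upto n (toℕ i ≡ᵇ_)
      i∈S : i ∈ S
      i∈S = true⇒∈ (trans (upto-lookup (toℕ i ≡ᵇ_) i) (≡ᵇ-refl (toℕ i)))
      S⊆η : S ⊆ η
      S⊆η {j} j∈ with refl ← toℕ-injective (≡ᵇ⇒≡ (toℕ i) (toℕ j)
        (subst T (trans (sym (∈⇒true j∈)) (upto-lookup (toℕ i ≡ᵇ_) j)) _)) = true⇒∈ ηi
      k≤ : ∀ k → k ≤ 1 + (k ∸ 1)
      k≤ zero    = z≤n
      k≤ (suc k) = ≤-refl
      1≤S : 1 ≤ ∣ S ∣
      1≤S = ≤-trans (≤-trans (s≤s z≤n) (rank-< S {toℕ i} (trans (at-lookup false S i) (∈⇒true i∈S)) (toℕ<n i))) (≤-reflexive (size≡∣∣ S))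

-- Cocycles and hitting sets

∑₂-zero : ∀ {m} (f : Fin m → Bool) → (∀ i → f i ≡ false) → ∑₂ f ≡ false
∑₂-zero {m} f f≡0 = trans (sum-cong-≗ f≡0) (sum-replicate-zero m)

∑₂-true : ∀ {m} (f : Fin m → Bool) → ∑₂ f ≡ true → ∃[ i ] f i ≡ true
∑₂-true {m} f odd with ∑₂-differ f (λ _ → false) (λ e → true≢false (trans (sym odd) (trans e (sum-replicate-zero m))))
... | i , ne with f i in fi
...   | true  = i , fi
...   | false = ⊥-elim (ne refl)

-- The characteristic vector of ⁅ i ⁆ is a Kronecker delta.
∑₂-pick : ∀ {m} (f : Fin m → Bool) i → ∑₂ (λ l → f l ∧ lookup ⁅ i ⁆ l) ≡ f i
∑₂-pick {suc m} f zero = trans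
  (cong₂ _xor_ (Boolₚ.∧-identityʳ (f zero))
    (∑₂-zero _ (λ l → trans (cong (f (suc l) ∧_) (lookup-replicate l false)) (Boolₚ.∧-zeroʳ (f (suc l))))))
  (Boolₚ.xor-identityʳ (f zero))
∑₂-pick {suc m} f (suc i) = cong₂ _xor_ (Boolₚ.∧-zeroʳ (f zero)) (∑₂-pick (f ∘ suc) i)

∑₂-swap : ∀ {l m} (a : Fin l → Bool) (facet? : Fin l → Fin m → Bool) (c : Fin m → Bool) →
  ∑₂ (λ i → a i ∧ ∑₂ (λ j → facet? i j ∧ c j)) ≡ ∑₂ (λ j → ∑₂ (λ i → a i ∧ facet? i j) ∧ c j)
∑₂-swap a facet? c = begin
  ∑₂ (λ i → a i ∧ ∑₂ (λ j → facet? i j ∧ c j))    ≡⟨ sum-cong-≗ (λ i → *-distribˡ-sum (a i) (λ j → facet? i j ∧ c j)) ⟩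
  ∑₂ (λ i → ∑₂ (λ j → a i ∧ (facet? i j ∧ c j)))  ≡⟨ ∑-comm (λ i j → a i ∧ (facet? i j ∧ c j)) ⟩
  ∑₂ (λ j → ∑₂ (λ i → a i ∧ (facet? i j ∧ c j)))  ≡⟨ sum-cong-≗ (λ j → sum-cong-≗ (λ i → sym (Boolₚ.∧-assoc (a i) (facet? i j) (c j)))) ⟩
  ∑₂ (λ j → ∑₂ (λ i → (a i ∧ facet? i j) ∧ c j))  ≡⟨ sum-cong-≗ (λ j → sym (*-distribʳ-sum (c j) (λ i → a i ∧ facet? i j))) ⟩
  ∑₂ (λ j → ∑₂ (λ i → a i ∧ facet? i j) ∧ c j)    ∎
  where open ≡-Reasoning

·-comm : ∀ {m} (p q : Subset m) → p · q ≡ q · p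
·-comm p q = sum-cong-≗ (λ i → Boolₚ.∧-comm (lookup p i) (lookup q i))

∩-· : ∀ {m} (p S q : Subset m) → (p ∩ S) · q ≡ p · (q ∩ S)
∩-· p S q = sum-cong-≗ (λ i → begin
  lookup (p ∩ S) i ∧ lookup q i              ≡⟨ cong (_∧ lookup q i) (lookup-zipWith _∧_ i p S) ⟩
  (lookup p i ∧ lookup S i) ∧ lookup q i     ≡⟨ Boolₚ.∧-assoc (lookup p i) _ _ ⟩
  lookup p i ∧ (lookup S i ∧ lookup q i)     ≡⟨ cong (lookup p i ∧_) (Boolₚ.∧-comm (lookup S i) _) ⟩
  lookup p i ∧ (lookup q i ∧ lookup S i)     ≡⟨ cong (lookup p i ∧_) (lookup-zipWith _∧_ i q S) ⟨
  lookup p i ∧ lookup (q ∩ S) i              ∎)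
  where open ≡-Reasoning

-- The Fredholm alternative: a vector v is a combination of the vectors g j, or
-- some η is orthogonal to all of them but not to v.  In the induction step, if η
-- is orthogonal to all but the first vector g₀, apply the hypothesis to g₀ + v.
-- The η′ it yields distinguishes v from g₀, so one of η′ and η + η′ will do.
fredholm : ∀ {n} m (g : Fin m → Subset n) (v : Subset n) →
    (∃ λ (c : Fin m → Bool) → ∀ i → lookup v i ≡ ∑₂ (λ j → c j ∧ lookup (g j) i))
  ⊎ (∃[ η ] ((∀ j → g j · η ≡ false) × v · η ≡ true))
fredholm zero g v with Finₚ.any? (λ i → lookup v i Boolₚ.≟ true)
... | holds (i , vi) = inj₂ (⁅ i ⁆ , (λ ()) , trans (∑₂-pick (lookup v) i) vi)
... | fails none     = inj₁ ((λ ()) , λ i → Boolₚ.¬-not (λ vi → none (i , vi)))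
fredholm (suc m) g v with fredholm m (g ∘ suc) v
... | inj₁ (c , eq) = inj₁ ((λ { zero → false ; (suc j) → c j }) , eq)
... | inj₂ (η , g⊥η , vη) with g zero · η in g₀η
...   | false = inj₂ (η , (λ { zero → g₀η ; (suc j) → g⊥η j }) , vη)
...   | true with fredholm m (g ∘ suc) (g zero ⊕₂ v)
...     | inj₁ (c , eq) = inj₁ ((λ { zero → true ; (suc j) → c j }) , λ i → begin
  lookup v i                                                       ≡⟨ cong (_xor lookup v i) (Boolₚ.xor-same (lookup (g zero) i)) ⟨
  (lookup (g zero) i xor lookup (g zero) i) xor lookup v i         ≡⟨ Boolₚ.xor-assoc (lookup (g zero) i) _ _ ⟩
  lookup (g zero) i xor (lookup (g zero) i xor lookup v i)         ≡⟨ cong (lookup (g zero) i xor_) (lookup-zipWith _xor_ i (g zero) v) ⟨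
  lookup (g zero) i xor lookup (g zero ⊕₂ v) i                     ≡⟨ cong (lookup (g zero) i xor_) (eq i) ⟩
  lookup (g zero) i xor ∑₂ (λ j → c j ∧ lookup (g (suc j)) i)      ∎)
  where open ≡-Reasoning
...     | inj₂ (η′ , g⊥η′ , sum-odd) with g zero · η′ in g₀η′
                                       | trans (trans (cong₂ _xor_ (·-comm (g zero) η′) (·-comm v η′)) (sym (·-⊕₂ η′ (g zero) v))) (trans (·-comm η′ (g zero ⊕₂ v)) sum-odd)
...       | false | vη′ = inj₂ (η′ , (λ { zero → g₀η′ ; (suc j) → g⊥η′ j }) , vη′)
...       | true  | vη′ = inj₂ (η ⊕₂ η′ ,
  (λ { zero    → trans (·-⊕₂ (g zero) η η′) (cong₂ _xor_ g₀η g₀η′)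
     ; (suc j) → trans (·-⊕₂ (g (suc j)) η η′) (cong₂ _xor_ (g⊥η j) (g⊥η′ j)) }) ,
  trans (·-⊕₂ v η η′) (trans (cong (_xor (v · η′)) vη) vη′))

does⇒ : ∀ {P : Set} (d : Dec P) → ⌊ d ⌋ ≡ true → P
does⇒ (holds p) _ = p

⇒does : ∀ {P : Set} (d : Dec P) → P → ⌊ d ⌋ ≡ true
⇒does (holds _) _ = refl
⇒does (fails ¬p) p = ⊥-elim (¬p p)

iff⇒≡ : ∀ {a b} → (a ≡ true → b ≡ true) → (b ≡ true → a ≡ true) → a ≡ b
iff⇒≡ {false} {false} f g = refl
iff⇒≡ {false} {true}  f g = g refl
iff⇒≡ {true}  {b}     f g = sym (f refl)

insertion : ∀ {m} {p q : Subset m} → p ⊆ q → ∣ q ∣ ≡ suc ∣ p ∣ → ∃[ x ] (x ∉ p × q ≡ p ∪ ⁅ x ⁆)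
insertion {p = p} {q} p⊆q card with Finₚ.any? (λ x → (x ∈? q) ×-dec ¬? (x ∈? p))
... | holds (x , x∈q , x∉p) = x , x∉p , sym (⊆-large⇒≡ p∪x⊆q (≤-trans (≤-reflexive card)
  (p⊂q⇒∣p∣<∣q∣ (p⊆p∪q ⁅ x ⁆ , x , q⊆p∪q p ⁅ x ⁆ (x∈⁅x⁆ x) , x∉p))))
  where
  p∪x⊆q : p ∪ ⁅ x ⁆ ⊆ q
  p∪x⊆q y∈ with x∈p∪q⁻ p ⁅ x ⁆ y∈
  ... | inj₁ y∈p = p⊆q y∈p
  ... | inj₂ y∈x with refl ← x∈⁅y⁆⇒x≡y x y∈x = x∈q
... | fails none = ⊥-elim (<⇒≱ (≤-reflexive (sym card)) (p⊆q⇒∣p∣≤∣q∣ q⊆p))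
  where
  q⊆p : q ⊆ p
  q⊆p {x} x∈q with x ∈? p
  ... | holds x∈p = x∈p
  ... | fails x∉p = ⊥-elim (none (x , x∈q , x∉p))

module _ (K : Complex) where
  open Complex K

  -- The incidence matrix: simplex i is a facet of simplex j.
  facet? : Fin n → Fin n → Bool
  facet? i j = ⌊ isFacet? i j ⌋

  card-pos : ∀ i → 1 ≤ ∣ simplex i ∣
  card-pos i with x , x∈ ← nonempty i = ≤-trans (≤-reflexive (sym (∣⁅x⁆∣≡1 x)))
    (p⊆q⇒∣p∣≤∣q∣ (λ y∈ → subst (_∈ simplex i) (sym (x∈⁅y⁆⇒x≡y x y∈)) x∈))

  facet-card : ∀ {i j} → IsFacet i j → ∣ simplex j ∣ ≡ suc ∣ simplex i ∣
  facet-card {i} {j} (_ , d) with ∣ simplex i ∣ | ∣ simplex j ∣ | card-pos i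
  ... | suc a | suc b | _ = cong suc d

  card-facet : ∀ {i j} → simplex i ⊆ simplex j → ∣ simplex j ∣ ≡ suc ∣ simplex i ∣ → IsFacet i j
  card-facet {i} {j} i⊆j card = i⊆j , trans (cong (_∸ 1) card) (sym (m+[n∸m]≡n (card-pos i)))

  -- If i and j are two dimensions apart, j having the vertices x and y in addition
  -- to those of i, then exactly i ∪ x and i ∪ y lie between them.
  diamond : ∀ i j → ∑₂ (λ l → facet? i l ∧ facet? l j) ≡ false
  diamond i j with Finₚ.any? (λ l → isFacet? i l ×-dec isFacet? l j)
  ... | fails none = ∑₂-zero _ (λ l → Boolₚ.¬-not (λ t → none (l ,
      does⇒ (isFacet? i l) (∧-true {facet? i l} t .proj₁) , does⇒ (isFacet? l j) (∧-true {facet? i l} t .proj₂))))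
  ... | holds (l₁ , i<l₁ , l₁<j)
    with x , x∉p , l₁≡ ← insertion (i<l₁ .proj₁) (facet-card {i} {l₁} i<l₁)
       | y , y∉l₁ , j≡ ← insertion (l₁<j .proj₁) (facet-card {l₁} {j} l₁<j)
    = trans (sum-cong-≗ two) (trans (∑-distrib-+ (lookup ⁅ l₁ ⁆) (lookup ⁅ l₂ ⁆))
        (cong₂ _xor_ (∑₂-pick (λ _ → true) l₁) (∑₂-pick (λ _ → true) l₂)))
    where
    p q : Subset vertices
    p = simplex i
    q = simplex j

    y∈q : y ∈ q
    y∈q = subst (y ∈_) (sym j≡) (q⊆p∪q (simplex l₁) ⁅ y ⁆ (x∈⁅x⁆ y))
    y∉p : y ∉ p
    y∉p y∈p = y∉l₁ (i<l₁ .proj₁ y∈p)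
    x∈l₁ : x ∈ simplex l₁
    x∈l₁ = subst (x ∈_) (sym l₁≡) (q⊆p∪q p ⁅ x ⁆ (x∈⁅x⁆ x))

    p∪y⊆q : p ∪ ⁅ y ⁆ ⊆ q
    p∪y⊆q z∈ with x∈p∪q⁻ p ⁅ y ⁆ z∈
    ... | inj₁ z∈p = l₁<j .proj₁ (i<l₁ .proj₁ z∈p)
    ... | inj₂ z∈y with refl ← x∈⁅y⁆⇒x≡y y z∈y = y∈q

    x∉p∪y : x ∉ p ∪ ⁅ y ⁆
    x∉p∪y x∈ with x∈p∪q⁻ p ⁅ y ⁆ x∈
    ... | inj₁ x∈p = x∉p x∈p
    ... | inj₂ x∈y with refl ← x∈⁅y⁆⇒x≡y y x∈y = y∉l₁ x∈l₁

    other : ∃[ l ] simplex l ≡ p ∪ ⁅ y ⁆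
    other = closed j (p ∪ ⁅ y ⁆) (y , q⊆p∪q p ⁅ y ⁆ (x∈⁅x⁆ y)) p∪y⊆q

    l₂ : Fin n
    l₂ = other .proj₁

    card₂ : ∣ p ∪ ⁅ y ⁆ ∣ ≡ suc ∣ p ∣
    card₂ = ≤-antisym
      (≤-pred (≤-trans (p⊂q⇒∣p∣<∣q∣ (p∪y⊆q , x , l₁<j .proj₁ x∈l₁ , x∉p∪y))
        (≤-reflexive (trans (facet-card {l₁} {j} l₁<j) (cong suc (facet-card {i} {l₁} i<l₁))))))
      (p⊂q⇒∣p∣<∣q∣ (p⊆p∪q ⁅ y ⁆ , y , q⊆p∪q p ⁅ y ⁆ (x∈⁅x⁆ y) , y∉p))

    i<l₂ : IsFacet i l₂
    i<l₂ = card-facet {i} {l₂} (λ z∈ → subst (_ ∈_) (sym (other .proj₂)) (p⊆p∪q ⁅ y ⁆ z∈))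
      (trans (cong ∣_∣ (other .proj₂)) card₂)

    l₂<j : IsFacet l₂ j
    l₂<j = card-facet {l₂} {j} (λ z∈ → p∪y⊆q (subst (_ ∈_) (other .proj₂) z∈))
      (trans (facet-card {l₁} {j} l₁<j) (cong suc (trans (facet-card {i} {l₁} i<l₁)
        (sym (trans (cong ∣_∣ (other .proj₂)) card₂)))))

    l₁≢l₂ : l₁ ≢ l₂
    l₁≢l₂ eq = x∉p∪y (subst (x ∈_) (trans (cong simplex eq) (other .proj₂)) x∈l₁)

    only : ∀ l → IsFacet i l → IsFacet l j → l ≡ l₁ ⊎ l ≡ l₂
    only l i<l l<j with z , z∉p , l≡ ← insertion (i<l .proj₁) (facet-card {i} {l} i<l)
      with x∈p∪q⁻ (simplex l₁) ⁅ y ⁆ (subst (z ∈_) j≡ (l<j .proj₁ (subst (z ∈_) (sym l≡) (q⊆p∪q p ⁅ z ⁆ (x∈⁅x⁆ z)))))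
    ... | inj₂ z∈y with refl ← x∈⁅y⁆⇒x≡y y z∈y = inj₂ (distinct (trans l≡ (sym (other .proj₂))))
    ... | inj₁ z∈l₁ with x∈p∪q⁻ p ⁅ x ⁆ (subst (z ∈_) l₁≡ z∈l₁)
    ...   | inj₁ z∈p = ⊥-elim (z∉p z∈p)
    ...   | inj₂ z∈x with refl ← x∈⁅y⁆⇒x≡y x z∈x = inj₁ (distinct (trans l≡ (sym l₁≡)))

    ⁅⁆-≢ : ∀ {a b : Fin n} → a ≢ b → lookup ⁅ a ⁆ b ≡ false
    ⁅⁆-≢ {a} a≢b = Boolₚ.¬-not (λ t → a≢b (sym (x∈⁅y⁆⇒x≡y a (true⇒∈ t))))

    ⁅⁆-refl : ∀ (a : Fin n) → lookup ⁅ a ⁆ a ≡ true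
    ⁅⁆-refl a = ∈⇒true (x∈⁅x⁆ a)

    two : ∀ l → facet? i l ∧ facet? l j ≡ lookup ⁅ l₁ ⁆ l xor lookup ⁅ l₂ ⁆ l
    two l = iff⇒≡ to from
      where
      to : facet? i l ∧ facet? l j ≡ true → lookup ⁅ l₁ ⁆ l xor lookup ⁅ l₂ ⁆ l ≡ true
      to t with only l (does⇒ (isFacet? i l) (∧-true {facet? i l} t .proj₁)) (does⇒ (isFacet? l j) (∧-true {facet? i l} t .proj₂))
      ... | inj₁ refl = cong₂ _xor_ (⁅⁆-refl l₁) (⁅⁆-≢ (l₁≢l₂ ∘ sym))
      ... | inj₂ refl = cong₂ _xor_ (⁅⁆-≢ l₁≢l₂) (⁅⁆-refl l₂)
      from : lookup ⁅ l₁ ⁆ l xor lookup ⁅ l₂ ⁆ l ≡ true → facet? i l ∧ facet? l j ≡ true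
      from t with lookup ⁅ l₁ ⁆ l in e₁ | lookup ⁅ l₂ ⁆ l in e₂
      ... | true  | false with refl ← x∈⁅y⁆⇒x≡y l₁ (true⇒∈ e₁) =
        cong₂ _∧_ (⇒does (isFacet? i l₁) i<l₁) (⇒does (isFacet? l₁ j) l₁<j)
      ... | false | true  with refl ← x∈⁅y⁆⇒x≡y l₂ (true⇒∈ e₂) =
        cong₂ _∧_ (⇒does (isFacet? i l₂) i<l₂) (⇒does (isFacet? l₂ j) l₂<j)

  ∂-lookup : ∀ c i → lookup (∂ c) i ≡ ∑₂ (λ j → facet? i j ∧ lookup c j)
  ∂-lookup c i = lookup∘tabulate _ i

  ext : ∀ {m} {p q : Subset m} → (∀ i → lookup p i ≡ lookup q i) → p ≡ q
  ext {p = p} {q} eq = trans (sym (tabulate∘lookup p)) (trans (tabulate-cong eq) (tabulate∘lookup q))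

  ∂∂≡∅ : ∀ c → ∂ (∂ c) ≡ ∅
  ∂∂≡∅ c = ext λ i → begin
    lookup (∂ (∂ c)) i                                ≡⟨ ∂-lookup (∂ c) i ⟩
    ∑₂ (λ l → facet? i l ∧ lookup (∂ c) l)                 ≡⟨ sum-cong-≗ (λ l → cong (facet? i l ∧_) (∂-lookup c l)) ⟩
    ∑₂ (λ l → facet? i l ∧ ∑₂ (λ j → facet? l j ∧ lookup c j))  ≡⟨ ∑₂-swap (facet? i) facet? (lookup c) ⟩
    ∑₂ (λ j → ∑₂ (λ l → facet? i l ∧ facet? l j) ∧ lookup c j)  ≡⟨ ∑₂-zero _ (λ j → cong (_∧ lookup c j) (diamond i j)) ⟩
    false                                             ≡⟨ lookup-replicate i false ⟨
    lookup ∅ i                                        ∎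
    where open ≡-Reasoning

  ∂-⊞ : ∀ a b → ∂ (a ⊞ b) ≡ ∂ a ⊞ ∂ b
  ∂-⊞ a b = ext λ i → trans (∂-lookup (a ⊞ b) i) (trans (trans (cong-row i a b)
    (cong₂ _xor_ (sym (∂-lookup a i)) (sym (∂-lookup b i)))) (sym (lookup-zipWith _xor_ i (∂ a) (∂ b))))
    where
    cong-row : ∀ i a b → ∑₂ (λ j → facet? i j ∧ lookup (a ⊞ b) j) ≡ ∑₂ (λ j → facet? i j ∧ lookup a j) xor ∑₂ (λ j → facet? i j ∧ lookup b j)
    cong-row i a b = trans
      (sum-cong-≗ (λ j → trans (cong (facet? i j ∧_) (lookup-zipWith _xor_ j a b)) (Boolₚ.∧-distribˡ-xor (facet? i j) _ _)))
      (∑-distrib-+ (λ j → facet? i j ∧ lookup a j) (λ j → facet? i j ∧ lookup b j))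

  ∂-dim : ∀ {r b} → OfDim (suc r) b → OfDim r (∂ b)
  ∂-dim {r} {b} dim-b {i} i∈ with ∑₂-true _ (trans (sym (∂-lookup b i)) (∈⇒true i∈))
  ... | j , t with ∧-true {facet? i j} t
  ...   | Fij , bj = suc-injective (trans (sym (does⇒ (isFacet? i j) Fij .proj₂)) (dim-b (true⇒∈ bj)))

-- The set facets j consists of the facets of j if j has dimension r + 1, and is empty
-- otherwise.
module Duality (I : THSInstance) (facets : Fin (THSInstance.n I) → Subset (THSInstance.n I))
  (facets-lookup : ∀ j i → lookup (facets j) i ≡ facet? (THSInstance.K I) i j ∧ ⌊ THSInstance.dim I j ≟ suc (THSInstance.r I) ⌋)
  where
  open THSInstance I

  private
    f : Fin n → Fin n → Bool
    f = facet? K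

  -- A cocycle pairing to 1 with ζ.
  Cocycle : Subset n → Set
  Cocycle η = (∀ j → facets j · η ≡ false) × ζ · η ≡ true

  -- By adjunction the value of a cocycle on ∂ b is the value of its coboundary on
  -- b, which is 0.
  cocycle-hits : ∀ {η} → OfDim r η → Cocycle η → HittingSet η
  cocycle-hits {η} dimη (δη≡0 , ζη) = dimη , λ z _ hom → meets z hom
    where
    on-boundary : ∀ b → OfDim (suc r) b → η · ∂ b ≡ false
    on-boundary b dim-b = begin
      ∑₂ (λ i → lookup η i ∧ lookup (∂ b) i)                   ≡⟨ sum-cong-≗ (λ i → cong (lookup η i ∧_) (∂-lookup K b i)) ⟩
      ∑₂ (λ i → lookup η i ∧ ∑₂ (λ j → f i j ∧ lookup b j))    ≡⟨ ∑₂-swap (lookup η) f (lookup b) ⟩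
      ∑₂ (λ j → ∑₂ (λ i → lookup η i ∧ f i j) ∧ lookup b j)    ≡⟨ ∑₂-zero _ column ⟩
      false                                                    ∎
      where
      open ≡-Reasoning
      column : ∀ j → ∑₂ (λ i → lookup η i ∧ f i j) ∧ lookup b j ≡ false
      column j with lookup b j in bj
      ... | false = Boolₚ.∧-zeroʳ _
      ... | true  = trans (Boolₚ.∧-identityʳ _) (trans (sum-cong-≗ (λ i → cong (lookup η i ∧_) (sym
        (trans (facets-lookup j i) (trans (cong (f i j ∧_) (⇒does (dim j ≟ suc r) (dim-b (true⇒∈ bj)))) (Boolₚ.∧-identityʳ (f i j)))))))
        (trans (·-comm η (facets j)) (δη≡0 j)))

    meets : ∀ z → Homologous r z ζ → Nonempty (η ∩ z)
    meets z (b , dim-b , ∂b≡) with ∑₂-true _ ηz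
      where
      ηz : η · z ≡ true
      ηz = xor-false (trans (sym (·-⊕₂ η z ζ)) (trans (cong (η ·_) (sym ∂b≡)) (on-boundary b dim-b)))
             (trans (·-comm η ζ) ζη)
        where
        xor-false : ∀ {a b} → a xor b ≡ false → b ≡ true → a ≡ true
        xor-false {true} _ _ = refl
        xor-false {false} e refl with () ← e
    ... | i , t with ∧-true {lookup η i} t
    ...   | ηi , zi = i , x∈p∩q⁺ (true⇒∈ ηi , true⇒∈ zi)

  -- Restricting everything to S, the functional given by the Fredholm alternative
  -- may be cut down to S.  In the other case ζ and a boundary agree on S, and
  -- their sum is a cycle homologous to ζ that avoids S.
  hitting-contains : ∀ {S} → HittingSet S → ∃[ η ] (η ⊆ S × Cocycle η)
  hitting-contains {S} (dimS , hits) with fredholm n (λ j → facets j ∩ S) (ζ ∩ S)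
  ... | inj₂ (η , g⊥η , vη) = η ∩ S , p∩q⊆q η S ,
    (λ j → trans (sym (∩-· (facets j) S η)) (g⊥η j)) , trans (sym (∩-· ζ S η)) vη
  ... | inj₁ (c , eq) = ⊥-elim (disjoint (hits z (z-dim , z-cycle) (b , b-dim , sym z⊞ζ)))
    where
    top : Fin n → Bool
    top j = ⌊ dim j ≟ suc r ⌋

    b z : Chain
    b = tabulate (λ j → top j ∧ c j)
    z = ζ ⊞ ∂ b

    b-dim : OfDim (suc r) b
    b-dim {j} j∈ = does⇒ (dim j ≟ suc r) (∧-true {top j} (trans (sym (lookup∘tabulate _ j)) (∈⇒true j∈)) .proj₁)

    z-dim : OfDim r z
    z-dim {i} i∈ with lookup ζ i in ζi
    ... | true  = cycle .proj₁ (true⇒∈ ζi)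
    ... | false = ∂-dim K b-dim (true⇒∈ (trans (cong (_xor lookup (∂ b) i) (sym ζi))
      (trans (sym (lookup-zipWith _xor_ i ζ (∂ b))) (∈⇒true i∈))))

    z-cycle : ∂ z ≡ ∅
    z-cycle = trans (∂-⊞ K ζ (∂ b)) (trans (cong₂ _⊞_ (cycle .proj₂) (∂∂≡∅ K b))
      (ext K (λ i → trans (lookup-zipWith _xor_ i ∅ ∅) (trans (Boolₚ.xor-same (lookup ∅ i)) (sym (lookup-replicate i false))))))

    z⊞ζ : z ⊞ ζ ≡ ∂ b
    z⊞ζ = ext K (λ i → begin
      lookup (z ⊞ ζ) i                                    ≡⟨ lookup-zipWith _xor_ i z ζ ⟩
      lookup z i xor lookup ζ i                           ≡⟨ cong (_xor lookup ζ i) (lookup-zipWith _xor_ i ζ (∂ b)) ⟩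
      (lookup ζ i xor lookup (∂ b) i) xor lookup ζ i      ≡⟨ cancel (lookup ζ i) (lookup (∂ b) i) ⟩
      lookup (∂ b) i                                      ∎)
      where
      open ≡-Reasoning
      cancel : ∀ a b → (a xor b) xor a ≡ b
      cancel false false = refl
      cancel false true  = refl
      cancel true  false = refl
      cancel true  true  = refl

    ∂b-on-S : ∀ i → lookup S i ≡ true → lookup ζ i ≡ lookup (∂ b) i
    ∂b-on-S i Si = begin
      lookup ζ i                                       ≡⟨ Boolₚ.∧-identityʳ (lookup ζ i) ⟨
      lookup ζ i ∧ true                                ≡⟨ cong (lookup ζ i ∧_) Si ⟨
      lookup ζ i ∧ lookup S i                          ≡⟨ lookup-zipWith _∧_ i ζ S ⟨
      lookup (ζ ∩ S) i                                 ≡⟨ eq i ⟩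
      ∑₂ (λ j → c j ∧ lookup (facets j ∩ S) i)            ≡⟨ sum-cong-≗ term ⟩
      ∑₂ (λ j → f i j ∧ lookup b j)                    ≡⟨ ∂-lookup K b i ⟨
      lookup (∂ b) i                                   ∎
      where
      open ≡-Reasoning
      term : ∀ j → c j ∧ lookup (facets j ∩ S) i ≡ f i j ∧ lookup b j
      term j = begin
        c j ∧ lookup (facets j ∩ S) i              ≡⟨ cong (c j ∧_) (lookup-zipWith _∧_ i (facets j) S) ⟩
        c j ∧ (lookup (facets j) i ∧ lookup S i)   ≡⟨ cong (λ s → c j ∧ (lookup (facets j) i ∧ s)) Si ⟩
        c j ∧ (lookup (facets j) i ∧ true)         ≡⟨ cong (c j ∧_) (Boolₚ.∧-identityʳ (lookup (facets j) i)) ⟩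
        c j ∧ lookup (facets j) i                  ≡⟨ cong (c j ∧_) (facets-lookup j i) ⟩
        c j ∧ (f i j ∧ top j)                   ≡⟨ Boolₚ.∧-comm (c j) _ ⟩
        (f i j ∧ top j) ∧ c j                   ≡⟨ Boolₚ.∧-assoc (f i j) _ _ ⟩
        f i j ∧ (top j ∧ c j)                   ≡⟨ cong (f i j ∧_) (lookup∘tabulate _ j) ⟨
        f i j ∧ lookup b j                      ∎

    disjoint : ¬ Nonempty (S ∩ z)
    disjoint (i , i∈) with i∈S , i∈z ← x∈p∩q⁻ S z i∈ = true≢false (trans (sym (∈⇒true i∈z))
      (trans (lookup-zipWith _xor_ i ζ (∂ b)) (trans (cong (_xor lookup (∂ b) i) (∂b-on-S i (∈⇒true i∈S)))
        (Boolₚ.xor-same (lookup (∂ b) i)))))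

-- The algorithm and its running time

least : ∀ {m} {V : Subset m → Set} → Decidable V → ∀ {η} → V η →
  ∃[ μ ] (V μ × (∀ T → V T → ∣ μ ∣ ≤ ∣ T ∣))
least {V = V} V? {η} v = go ∣ η ∣ ≤-refl v
  where
  go : ∀ b {η} → ∣ η ∣ ≤ b → V η → ∃[ μ ] (V μ × (∀ T → V T → ∣ μ ∣ ≤ ∣ T ∣))
  go b {η} η≤b v with anySubset? (λ T → V? T ×-dec (∣ T ∣ <? ∣ η ∣))
  ... | fails none = η , v , λ T vT → ≮⇒≥ (λ lt → none (T , vT , lt))
  go zero    η≤b v | holds (T , vT , lt) = ⊥-elim (n≮0 (≤-trans lt η≤b))
  go (suc b) η≤b v | holds (T , vT , lt) = go b (≤-pred (≤-trans lt η≤b)) vT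

∣p-x∣ : ∀ {m} {p : Subset m} {x} → x ∈ p → ∣ p ∣ ≡ suc ∣ p - x ∣
∣p-x∣ {p = true ∷ p} here = cong suc (cong ∣_∣ (sym (p─⊥≡p p)))
∣p-x∣ {p = true ∷ p} (there x∈p) = cong suc (∣p-x∣ x∈p)
∣p-x∣ {p = false ∷ p} (there x∈p) = ∣p-x∣ x∈p

card⇒inhabited : ∀ {m} (p : Subset m) → 1 ≤ ∣ p ∣ → Nonempty p
card⇒inhabited (true  ∷ p) _ = zero , here
card⇒inhabited (false ∷ p) c with x , x∈ ← card⇒inhabited p c = suc x , there x∈

inhabited⇒card : ∀ {m} {p : Subset m} {x} → x ∈ p → 1 ≤ ∣ p ∣
inhabited⇒card x∈ = ≤-trans (s≤s z≤n) (≤-reflexive (sym (∣p-x∣ x∈)))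

cell-bits : ∀ {m} (p : Subset m) ys i → i < m → cell (bits p ++ ys) i ≡ bit (p ‼ i)
cell-bits (b ∷ p) ys zero    _         = refl
cell-bits (b ∷ p) ys (suc i) (s≤s i<m) = cell-bits p ys i i<m

cell-skip : ∀ {m} (p : Subset m) ys i → cell (bits p ++ ys) (m + i) ≡ cell ys i
cell-skip []      ys i = refl
cell-skip (b ∷ p) ys i = cell-skip p ys i

cell-concat : ∀ {A : Set} {v} m (g : Fin m → A) (f : A → Subset v) j x → x < v →
  cell (concatMap (λ a → bits (f a)) (List.tabulate g)) (toℕ j * v + x) ≡ bit (f (g j) ‼ x)
cell-concat (suc m) g f zero x x<v = cell-bits (f (g zero)) _ x x<v
cell-concat {v = v} (suc m) g f (suc j) x x<v = trans
  (cong (cell (concatMap (λ a → bits (f a)) (List.tabulate g))) (+-assoc v (toℕ j * v) x))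
  (trans (cell-skip (f (g zero)) _ (toℕ j * v + x)) (cell-concat m (g ∘ suc) f j x x<v))

length-bits : ∀ {m} (p : Subset m) → length (bits p) ≡ m
length-bits []      = refl
length-bits (b ∷ p) = cong suc (length-bits p)

lookup-bits : ∀ {m} (p : Subset m) i → List.lookup (bits p) i ≡ bit (p ‼ toℕ i)
lookup-bits (b ∷ p) zero    = refl
lookup-bits (b ∷ p) (suc i) = lookup-bits p i

excess-zero : ∀ {v} (p q : Subset v) → (excess p q ≡ᵇ 0) ≡ true → p ⊆ q
excess-zero {v} p q eq {x} x∈p with lookup q x in qx
... | true  = true⇒∈ qx
... | false = ⊥-elim (n≮0 (≤-trans positive (≤-reflexive (≡ᵇ⇒≡ _ 0 (subst T (sym eq) _)))))
  where
  f : ℕ → ℕ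
  f y = bit (p ‼ y) ∸ bit (q ‼ y)
  positive : 1 ≤ excess p q
  positive = ≤-trans (≤-trans (≤-reflexive (sym (cong₂ (λ a b → bit a ∸ bit b)
      (trans (at-lookup false p x) (∈⇒true x∈p)) (trans (at-lookup false q x) qx))))
      (m≤m+n (f (toℕ x)) (sumTo (toℕ x) f)))
    (sumTo-mono f (Finₚ.toℕ<n x))

⊆⇒excess-zero : ∀ {v} (p q : Subset v) → p ⊆ q → excess p q ≡ 0
⊆⇒excess-zero {v} p q p⊆q = go v ≤-refl
  where
  f : ℕ → ℕ
  f y = bit (p ‼ y) ∸ bit (q ‼ y)
  none : ∀ (x : Fin v) → f (toℕ x) ≡ 0
  none x with lookup p x in px
  ... | false = trans (cong (λ a → bit a ∸ bit (q ‼ toℕ x)) (trans (at-lookup false p x) px)) (0∸n≡0 (bit (q ‼ toℕ x)))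
  ... | true  = cong₂ (λ a b → bit a ∸ bit b) (trans (at-lookup false p x) px)
                  (trans (at-lookup false q x) (∈⇒true (p⊆q (true⇒∈ px))))
  go : ∀ i → i ≤ v → sumTo i f ≡ 0
  go zero    _   = refl
  go (suc i) i<v = cong₂ _+_ (subst (λ z → f z ≡ 0) (Finₚ.toℕ-fromℕ< i<v) (none (fromℕ< i<v))) (go i (<⇒≤ i<v))

≡ᵇ-true : ∀ {a b} → a ≡ b → (a ≡ᵇ b) ≡ true
≡ᵇ-true {a} refl = ≡ᵇ-refl a

true-≡ᵇ : ∀ a b → (a ≡ᵇ b) ≡ true → a ≡ b
true-≡ᵇ a b eq = ≡ᵇ⇒≡ a b (subst T (sym eq) _)

module Solve (I : THSInstance) where
  open THSInstance I

  simplexAt : ℕ → Subset vertices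
  simplexAt = at (replicate vertices false) (tabulate simplex)

  simplexAt-simplex : ∀ j → simplexAt (toℕ j) ≡ simplex j
  simplexAt-simplex j = trans (at-lookup _ (tabulate simplex) j) (lookup∘tabulate simplex j)

  row : ℕ → Subset n
  row = facet-row n r simplexAt

  facets : Fin n → Subset n
  facets j = row (suc (toℕ j))

  facets-lookup : ∀ j i → lookup (facets j) i ≡ facet? K i j ∧ ⌊ dim j ≟ suc r ⌋
  facets-lookup j i = trans (upto-lookup (λ i → incident r (simplexAt i) (simplexAt (toℕ j))) i)
    (trans (cong₂ (incident r) (simplexAt-simplex i) (simplexAt-simplex j)) (iff⇒≡ to from))
    where
    p q : Subset vertices
    p = simplex i
    q = simplex j
    to : incident r p q ≡ true → facet? K i j ∧ ⌊ dim j ≟ suc r ⌋ ≡ true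
    to t with t₁ , t₂ ← ∧-true {(excess p q ≡ᵇ 0) ∧ (size p ∸ 1 ≡ᵇ r)} t
         with t₃ , t₄ ← ∧-true {excess p q ≡ᵇ 0} t₁ =
      cong₂ _∧_ (⇒does (isFacet? i j) ((λ {x} → excess-zero p q t₃ {x}) , trans dim-j (cong suc (sym dim-i)))) (⇒does (dim j ≟ suc r) dim-j)
      where
      dim-j : dim j ≡ suc r
      dim-j = trans (cong (_∸ 1) (sym (size≡∣∣ q))) (true-≡ᵇ _ _ t₂)
      dim-i : dim i ≡ r
      dim-i = trans (cong (_∸ 1) (sym (size≡∣∣ p))) (true-≡ᵇ _ _ t₄)
    from : facet? K i j ∧ ⌊ dim j ≟ suc r ⌋ ≡ true → incident r p q ≡ true
    from t with t₁ , t₂ ← ∧-true {facet? K i j} t with p⊆q , d ← does⇒ (isFacet? i j) t₁ =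
      cong₂ _∧_ (cong₂ _∧_ (≡ᵇ-true (⊆⇒excess-zero p q p⊆q))
        (≡ᵇ-true (trans (cong (_∸ 1) (size≡∣∣ p)) (suc-injective (trans (sym d) dim-j)))))
        (≡ᵇ-true (trans (cong (_∸ 1) (size≡∣∣ q)) dim-j))
      where
      dim-j : dim j ≡ suc r
      dim-j = does⇒ (dim j ≟ suc r) t₂

  open Duality I facets facets-lookup

  row-0 : ∀ i → lookup (row 0) i ≡ false
  row-0 i = upto-lookup (λ _ → false) i

  open Completeness row row-0 ζ

  valid⇒cocycle : ∀ η → Valid η → Cocycle η
  valid⇒cocycle η (even , odd) = (λ j → even (toℕ j) (Finₚ.toℕ<n j)) , odd

  cocycle⇒valid : ∀ η → Cocycle η → Valid η
  cocycle⇒valid η (even , odd) =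
    (λ t t<n → subst (λ u → row (suc u) · η ≡ false) (Finₚ.toℕ-fromℕ< t<n) (even (fromℕ< t<n))) , odd

  cocycle? : Decidable Cocycle
  cocycle? η = Finₚ.all? (λ j → (facets j · η) Boolₚ.≟ false) ×-dec ((ζ · η) Boolₚ.≟ true)

  minimal-in : ∀ {S} → HittingSet S → ∃[ μ ] (Minimal μ × ∣ μ ∣ ≤ ∣ S ∣)
  minimal-in hit with η , η⊆S , coc ← hitting-contains hit
                 with μ , μ-coc , lowest ← least cocycle? {η} coc =
    μ , (cocycle⇒valid μ μ-coc , λ T v → lowest T (valid⇒cocycle T v)) ,
    ≤-trans (lowest η coc) (p⊆q⇒∣p∣≤∣q∣ η⊆S)

  row-dim : ∀ t {i} → i ∈ row t → dim i ≡ r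
  row-dim zero    {i} i∈ = ⊥-elim (true≢false (trans (sym (∈⇒true i∈)) (row-0 i)))
  row-dim (suc t) {i} i∈ = trans (cong (_∸ 1) (trans (cong ∣_∣ (sym (simplexAt-simplex i))) (sym (size≡∣∣ (simplexAt (toℕ i))))))
    (true-≡ᵇ _ _ (∧-true {excess (simplexAt (toℕ i)) (simplexAt t) ≡ᵇ 0} (∧-true
      (trans (sym (upto-lookup (λ i → incident r (simplexAt i) (simplexAt t)) i)) (∈⇒true i∈)) .proj₁) .proj₂))

  pick-dim : ∀ t w {S} → OfDim r S → OfDim r (pick (row t) w S)
  pick-dim t w {S} dimS {i} i∈ with S ‼ toℕ i in Si
    | trans (sym (upto-lookup (λ x → S ‼ x ∨ (row t ‼ x ∧ (rank (row t) x ≡ᵇ w))) i)) (∈⇒true i∈)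
  ... | true  | _ = dimS (true⇒∈ (trans (sym (at-lookup false S i)) Si))
  ... | false | e = row-dim t (true⇒∈ (trans (sym (at-lookup false (row t) i)) (∧-true {row t ‼ toℕ i} {rank (row t) (toℕ i) ≡ᵇ w} e .proj₁)))

  run-dim : ∀ L q {S} → OfDim r S → OfDim r (run row B L q S)
  run-dim zero    q dimS = dimS
  run-dim (suc L) q {S} dimS = run-dim L _ (λ {i} → pick-dim (violation row n S) _ dimS {i})

  candidate-dim : ∀ L s q → ζ ‼ s ≡ true → OfDim r (candidate row B L s q)
  candidate-dim L s q ζs = run-dim L q (λ {i} i∈ → cycle .proj₁ (true⇒∈ (trans (sym (at-lookup false ζ i))
    (trans (cong (ζ ‼_) (sym (true-≡ᵇ s (toℕ i) (trans (sym (upto-lookup (s ≡ᵇ_) i)) (∈⇒true i∈))))) ζs))))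

  large-simplex : ∃[ j ] r < dim j
  large-simplex with Finₚ.any? (λ j → r <? dim j)
  ... | holds found = found
  ... | fails none  = ⊥-elim (<⇒≱ r<d (max≤v⁺ z≤n (Allₚ.map⁺ (Allₚ.tabulate⁺ (λ j → ≮⇒≥ (λ lt → none (j , lt)))))))

  1≤n : 1 ≤ n
  1≤n = ≤-trans (s≤s z≤n) (Finₚ.toℕ<n (large-simplex .proj₁))

  degree≤Δ : ∀ j → ∣ HasseNeighbours j ∣ ≤ Δ
  degree≤Δ = Allₚ.tabulate⁻ (Allₚ.map⁻ (xs≤max 0 (map (λ i → ∣ HasseNeighbours i ∣) (allFin n))))

  facet∈ : ∀ {i j} → IsFacet i j → i ∈ HasseNeighbours j
  facet∈ {i} {j} f = true⇒∈ (trans (lookup∘tabulate _ i)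
    (trans (cong (⌊ isFacet? j i ⌋ ∨_) (⇒does (isFacet? i j) f)) (Boolₚ.∨-zeroʳ _)))

  -- A simplex of positive dimension has a facet, obtained by removing a vertex.
  1≤Δ : 1 ≤ Δ
  1≤Δ with j , r<dim ← large-simplex
      with x , x∈ ← nonempty j
      with i , i≡ ← closed j (simplex j - x) (card⇒inhabited (simplex j - x)
        (≤-pred (≤-trans (s≤s (≤-trans (s≤s z≤n) r<dim)) (≤-trans (≤-reflexive (m+[n∸m]≡n (card-pos K j))) (≤-reflexive (∣p-x∣ x∈))))))
        (p─q⊆p (simplex j) ⁅ x ⁆)
      = ≤-trans (inhabited⇒card (facet∈ {i} {j} (card-facet K {i} {j} (λ {y} y∈ → p─q⊆p (simplex j) ⁅ x ⁆ (subst (y ∈_) i≡ y∈))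
          (trans (∣p-x∣ x∈) (cong (suc ∘ ∣_∣) (sym i≡)))))) (degree≤Δ j)

  -- Every vertex is a simplex.
  v≤n : vertices ≤ n
  v≤n = Finₚ.injective⇒≤ {f = λ x → singleton x .proj₁} (λ {x} {y} eq → x∈⁅y⁆⇒x≡y y (subst (x ∈_)
    (trans (sym (singleton x .proj₂)) (trans (cong simplex eq) (singleton y .proj₂))) (x∈⁅x⁆ x)))

  B≤Δ : B ≤ Δ
  B≤Δ = branching≤ row n 1≤Δ (λ t t<n → subst (λ u → size (row (suc u)) ≤ Δ) (Finₚ.toℕ-fromℕ< t<n) (bound (fromℕ< t<n)))
    where
    bound : ∀ j → size (facets j) ≤ Δ
    bound j = ≤-trans (≤-reflexive (size≡∣∣ (facets j))) (≤-trans (p⊆q⇒∣p∣≤∣q∣ {p = facets j} {q = HasseNeighbours j} (λ {i} i∈ →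
      facet∈ {i} {j} (does⇒ (isFacet? i j) (∧-true {facet? K i j} (trans (sym (facets-lookup j i)) (∈⇒true i∈)) .proj₁)))) (degree≤Δ j))

  B≤n : B ≤ n
  B≤n = branching≤ row n 1≤n (λ t _ → ≤-trans (≤-reflexive (size≡∣∣ (row (suc t)))) (∣p∣≤n (row (suc t))))

  -- The length of words, their number, and the common bound for both.
  L P N : ℕ
  L = k ∸ 1
  P = B ^ L
  N = (k * Δ) ^ k

  private
    ≤-power : ∀ a m → a ≤ a ^ suc m
    ≤-power zero m = z≤n
    ≤-power (suc a) m = ≤-trans (≤-reflexive (sym (*-identityʳ (suc a)))) (*-monoʳ-≤ (suc a) (m^n>0 (suc a) m))

    -- For k = 0 there is one word, of length 0; otherwise use B ≤ Δ ≤ k * Δ.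
    bounds : ∀ k → 1 ≤ (k * Δ) ^ k × k ∸ 1 ≤ (k * Δ) ^ k × B ^ (k ∸ 1) ≤ (k * Δ) ^ k
    bounds zero    = ≤-refl , z≤n , ≤-refl
    bounds (suc k) = ≤-trans 1≤kΔ (≤-power _ k)
                   , ≤-trans (≤-trans (n≤1+n k) k≤kΔ) (≤-power _ k)
                   , ≤-trans (^-monoˡ-≤ k (≤-trans B≤Δ (m≤n*m Δ (suc k)))) (m≤n*m _ (suc k * Δ) {{>-nonZero 1≤kΔ}})
      where
      k≤kΔ : suc k ≤ suc k * Δ
      k≤kΔ = m≤m*n (suc k) Δ {{>-nonZero 1≤Δ}}
      1≤kΔ : 1 ≤ suc k * Δ
      1≤kΔ = ≤-trans (s≤s z≤n) k≤kΔ

  1≤N : 1 ≤ N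
  1≤N = bounds k .proj₁
  L≤N : L ≤ N
  L≤N = bounds k .proj₂ .proj₁
  P≤N : P ≤ N
  P≤N = bounds k .proj₂ .proj₂

  open VerifyPrep {n} {vertices} 1≤n v≤n r simplexAt using (Input; keep-input; build-exec; count-exec)
  open VerifySearch 1≤n row ζ B L P k N 1≤N L≤N P≤N
  open Verify 1≤n row using (Rows; keep-rows; 1≤nn; n≤nn)

  M₀ : Memory
  M₀ = load (encodeTHS I)

  rest : List ℕ
  rest = concatMap (λ i → bits (simplex i)) (allFin n)

  simplexAt-input : ∀ t x → t < n → x < vertices → M₀ 0 (x + (t * vertices + (4 + n))) ≡ bit (simplexAt t ‼ x)
  simplexAt-input t x t<n x<v = trans (cong (M₀ 0) address) (trans (cell-skip ζ rest (t * vertices + x))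
    (subst (λ u → cell rest (u * vertices + x) ≡ bit (simplexAt u ‼ x)) (Finₚ.toℕ-fromℕ< t<n)
      (trans (cell-concat n id simplex (fromℕ< t<n) x x<v) (cong (λ p → bit (p ‼ x)) (sym (simplexAt-simplex (fromℕ< t<n)))))))
    where
    address : x + (t * vertices + (4 + n)) ≡ 4 + (n + (t * vertices + x))
    address = trans (sym (+-assoc x (t * vertices) (4 + n))) (trans (+-comm (x + t * vertices) (4 + n))
      (cong (λ z → 4 + (n + z)) (+-comm x (t * vertices))))

  input : Input M₀
  input = record { n-cell = refl ; v-cell = refl ; r-cell = refl ; simplexAt-cell = simplexAt-input }

  nnn≤X₄ : n * (n * n) ≤ X₄
  nnn≤X₄ = *-monoʳ-≤ n (≤-trans nn≤X₂ (K*-grows _))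
  nn≤X₄ : n * n ≤ X₄
  nn≤X₄ = ≤-trans (≤-trans (≤-reflexive (sym (*-identityˡ (n * n)))) (*-monoˡ-≤ (n * n) 1≤n)) nnn≤X₄
  1≤X₄ : 1 ≤ X₄
  1≤X₄ = ≤-trans 1≤nn nn≤X₄
  Nn≤X₄ : N * n ≤ X₄
  Nn≤X₄ = ≤-trans (*-monoʳ-≤ N n≤nn) (≤-trans (K*-grows _) (≤-trans (K*-grows _)
    (≤-trans (≤-reflexive (sym (*-identityˡ X₃))) (*-monoˡ-≤ X₃ 1≤n))))

  main-exec : Exec X₄ main M₀ Searched
  main-exec =
    write-then 1≤X₄ (then-exec (slower nnn≤X₄ (build-exec (keep-input (λ _ → refl) input) (λ _ → refl))) λ M₁ fr₁ rows₁ →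
    then-exec (slower nn≤X₄ (count-exec rows₁)) λ M₂ fr₂ branch₂ →
    then-exec (slower Nn≤X₄ (power-exec B L N branch₂ (trans (fr₂ rLen refl 0) (fr₁ rLen refl 0)) 1≤n B≤n 1≤N L≤N)) λ M₃ fr₃ pow₃ →
    let in₃ : ∀ j → M₃ 0 j ≡ M₀ 0 j
        in₃ = λ j → trans (fr₃ 0 refl j) (trans (fr₂ 0 refl j) (fr₁ 0 refl j))
    in
    write-then 1≤X₄ (search-exec
      (record
        { rows   = keep-rows (λ j → trans (fr₃ 0 refl j) (fr₂ 0 refl j)) (λ j → trans (fr₃ aRow refl j) (fr₂ aRow refl j)) rows₁
        ; ζ-cell = λ i i<n → trans (in₃ (4 + i)) (cell-bits ζ rest i i<n)
        ; B-cell = trans (fr₃ rBranch refl 0) branch₂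
        ; L-cell = trans (fr₃ rLen refl 0) (trans (fr₂ rLen refl 0) (fr₁ rLen refl 0)) })
      pow₃ (cong suc (in₃ 2)) (trans (fr₃ 1 refl 0) (trans (fr₂ 1 refl 0) (fr₁ 1 refl 0)))))

  accepted⇒valid : ∀ S → Accepted S → Valid S
  accepted⇒valid S (v , p) = violation-sound row n S v , trans (sym (parity≡· ζ S)) p

  valid⇒accepted : ∀ S → Valid S → Accepted S
  valid⇒accepted S (even , odd) = violation-none row n S even , trans (parity≡· ζ S) odd

  beats-minimal : ∀ {M} → Searched M → ∀ {η} → Minimal η → ∣ η ∣ ≤ k → M rBest 0 ≤ ∣ η ∣
  beats-minimal {M} (_ , done) {η} min η≤k =
    let (s , q , s<n , q<P , ζs , eq) = complete {η} k min η≤k in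
    ≤-trans (done s q s<n q<P ζs (subst Accepted (sym eq) (valid⇒accepted η (min .proj₁))))
      (≤-reflexive (trans (cong size eq) (size≡∣∣ η)))

  beats-hitting : ∀ {M} → Searched M → ∀ {T} → HittingSet T → ∣ T ∣ ≤ k → M rBest 0 ≤ ∣ T ∣
  beats-hitting {M} searched hit T≤k =
    let (μ , min , μ≤T) = minimal-in hit in
    ≤-trans (beats-minimal {M} searched {μ} min (≤-trans μ≤T T≤k)) μ≤T

  answer-none : ∀ {M} → Searched M → M rBest 0 ≡ suc k → THSAnswer I (0 ∷ [])
  answer-none {M} searched b = no λ (S , hit , S≤k) →
    <⇒≱ (≤-trans (≤-reflexive (sym b)) (beats-hitting {M} searched hit S≤k)) S≤k

  answer-some : ∀ {M} S → Searched M → OfDim r S → Accepted S → size S ≤ k → M rBest 0 ≡ size S →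
    THSAnswer I (1 ∷ bits S)
  answer-some {M} S searched dimS accepted S≤k b = yes S (hitting , minimum) ∣S∣≤k
    where
    ∣S∣≤k : ∣ S ∣ ≤ k
    ∣S∣≤k = ≤-trans (≤-reflexive (sym (size≡∣∣ S))) S≤k

    hitting : HittingSet S
    hitting = cocycle-hits {S} dimS (valid⇒cocycle S (accepted⇒valid S accepted))

    minimum : ∀ T → HittingSet T → ∣ S ∣ ≤ ∣ T ∣
    minimum T hit =
      [ (λ T≤k → ≤-trans (≤-reflexive (trans (sym (size≡∣∣ S)) (sym b))) (beats-hitting {M} searched hit T≤k))
      , ≤-trans ∣S∣≤k ]′ (≤-total ∣ T ∣ k)

  output-bits : ∀ {M} (S : Subset n) → M 1 0 ≡ 1 → (∀ i → i < n → M 1 (suc i) ≡ bit (S ‼ i)) → Output M (1 ∷ bits S)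
  output-bits S one copied zero    = one
  output-bits S one copied (suc i) =
    trans (copied (toℕ i) (≤-trans (Finₚ.toℕ<n i) (≤-reflexive (length-bits S)))) (sym (lookup-bits S i))

  answer : ∀ {M} → Searched M → ∃[ ys ] (Output M ys × THSAnswer I ys)
  answer {M} searched@(inj₁ (b , o) , _) = 0 ∷ [] , (λ { zero → o }) , answer-none {M} searched b
  answer {M} searched@(inj₂ (s , q , s<n , ζs , acc , S≤k , b , o , out) , _) =
    1 ∷ bits S , output-bits {M} S o out , answer-some {M} S searched (candidate-dim L s q ζs) acc S≤k b
    where
    S : Subset n
    S = candidate row B L s q

  X₄-bound : X₄ ≤ (k * Δ) ^ (3 * k) * n ^ 6
  X₄-bound = begin
    n * (N * (N * (N * (n * n))))   ≡⟨ cong (n *_) cube ⟩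
    n * (N ^ 3 * (n * n))           ≡⟨ swap n (N ^ 3) (n * n) ⟩
    N ^ 3 * (n * (n * n))           ≡⟨ cong₂ (λ a b → a * (n * (n * b))) power-N (sym (*-identityʳ n)) ⟩
    (k * Δ) ^ (3 * k) * n ^ 3       ≤⟨ *-monoʳ-≤ ((k * Δ) ^ (3 * k)) (^-monoʳ-≤ n {{>-nonZero 1≤n}} (m≤m+n 3 3)) ⟩
    (k * Δ) ^ (3 * k) * n ^ 6       ∎
    where
    open ≤-Reasoning
    swap : ∀ a b c → a * (b * c) ≡ b * (a * c)
    swap a b c = trans (sym (*-assoc a b c)) (trans (cong (_* c) (*-comm a b)) (*-assoc b a c))
    cube : N * (N * (N * (n * n))) ≡ N ^ 3 * (n * n)
    cube = sym (trans (*-assoc N (N * (N * 1)) (n * n)) (cong (N *_) (trans (*-assoc N (N * 1) (n * n))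
      (cong (N *_) (cong (_* (n * n)) (*-identityʳ N))))))
    power-N : N ^ 3 ≡ (k * Δ) ^ (3 * k)
    power-N = trans (^-*-assoc (k * Δ) k 3) (cong ((k * Δ) ^_) (*-comm k 3))

  -- A run of the program on the instance with a correct answer, within the time.
  record Solution : Set where
    field
      answer-list : List ℕ
      duration    : ℕ
      run-of      : Run main (encodeTHS I) answer-list duration
      is-answer   : THSAnswer I answer-list
      in-time     : duration ≤ weight main * (k * Δ) ^ (3 * k) * n ^ 6

  solve : Exec X₄ main M₀ Searched → Solution
  solve (exec {M} {t} halts fast searched) = record
    { answer-list = answer {M} searched .proj₁
    ; duration    = t
    ; run-of      = M , halts , answer {M} searched .proj₂ .proj₁
    ; is-answer   = answer {M} searched .proj₂ .proj₂
    ; in-time     = ≤-trans fast (≤-trans (*-monoʳ-≤ (weight main) X₄-bound)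
                      (≤-reflexive (sym (*-assoc (weight main) ((k * Δ) ^ (3 * k)) (n ^ 6)))))
    }

  solution : Solution
  solution = solve main-exec

  n≤size : n ≤ length (encodeTHS I)
  n≤size = ≤-trans (≤-trans (≤-reflexive (sym (length-bits ζ))) (≤-trans (m≤m+n _ (length rest))
    (≤-reflexive (sym (length-++ (bits ζ)))))) (m≤n+m _ 4)

-- Sums only are available to the program, so it computes a power by repeated
-- addition, as the algorithm does for the number of words.
bound-computable : ∀ C → Computable (λ x → (C + x) ^ (1 + 6 * x))
bound-computable C = P , λ x → go x
  where
  #x : Expr
  #x = read 0 (lit 0)
  P : Program
  P = (rBranch ≔ lit C ⊕ #x) ⨟
      (rLen ≔ lit 1 ⊕ (#x ⊕ (#x ⊕ (#x ⊕ (#x ⊕ (#x ⊕ (#x ⊕ lit 0))))))) ⨟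
      power ⨟
      write 1 (lit 0) (reg rPow)

  go : ∀ x → ∃[ t ] Run P (x ∷ []) ((C + x) ^ (1 + 6 * x) ∷ []) t
  go x = steps-of program-exec
    where
    b l : ℕ
    b = C + x
    l = 1 + 6 * x
    -- The budget has suc b as a factor because b may be 0.
    1≤ : 1 ≤ l * suc b
    1≤ = s≤s z≤n
    program-exec : Exec (l * suc b) P (load (x ∷ [])) (λ M → M 1 0 ≡ b ^ l)
    program-exec = write-then 1≤ (write-then 1≤ (then-exec
      (power-exec b l l refl refl (s≤s z≤n) (n≤1+n b) (s≤s z≤n) ≤-refl)
      (λ M fr p → exec-write 1≤ p)))
    steps-of : Exec (l * suc b) P (load (x ∷ [])) (λ M → M 1 0 ≡ b ^ l) → ∃[ t ] Run P (x ∷ []) (b ^ l ∷ []) t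
    steps-of (exec {M} {t} h _ q) = t , M , h , λ { zero → q }

-- Both k and Δ are at most y = W + (k + Δ), so k * Δ is at most y ^ 2.
fpt-bound : ∀ W k Δ → 1 ≤ Δ → W * (k * Δ) ^ (3 * k) ≤ (W + (k + Δ)) ^ (1 + 6 * (k + Δ))
fpt-bound W k Δ 1≤Δ = *-mono-≤ (m≤m+n W x) (begin
  (k * Δ) ^ (3 * k)       ≤⟨ ^-monoˡ-≤ (3 * k) (*-mono-≤ (≤-trans (m≤m+n k Δ) (m≤n+m x W)) Δ≤y1) ⟩
  (y ^ 2) ^ (3 * k)       ≡⟨ ^-*-assoc y 2 (3 * k) ⟩
  y ^ (2 * (3 * k))       ≡⟨ cong (y ^_) (*-assoc 2 3 k) ⟨
  y ^ (6 * k)             ≤⟨ ^-monoʳ-≤ y {{>-nonZero 1≤y}} (*-monoʳ-≤ 6 (m≤m+n k Δ)) ⟩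
  y ^ (6 * x)             ∎)
  where
  open ≤-Reasoning
  x y : ℕ
  x = k + Δ
  y = W + x
  Δ≤y : Δ ≤ y
  Δ≤y = ≤-trans (m≤n+m Δ k) (m≤n+m x W)
  Δ≤y1 : Δ ≤ y * 1
  Δ≤y1 = ≤-trans Δ≤y (≤-reflexive (sym (*-identityʳ y)))
  1≤y : 1 ≤ y
  1≤y = ≤-trans 1≤Δ Δ≤y

*-^ : ∀ a b q → (a * b) ^ q ≡ a ^ q * b ^ q
*-^ a b zero    = refl
*-^ a b (suc q) = trans (cong (a * b *_) (*-^ a b q)) ([m*n]*[o*p]≡[m*o]*[n*p] a b (a ^ q) (b ^ q))

-- As every admissible exponent p / q is at least 0, a bound by n ^ e suffices.
ω-bound : ∀ t D n e → 1 ≤ n → t ≤ D * n ^ e → t ≤ D · n ^[ e +ω]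
ω-bound t D n e 1≤n t≤ p q _ = begin
  t ^ q                      ≤⟨ ^-monoˡ-≤ q t≤ ⟩
  (D * n ^ e) ^ q            ≡⟨ *-^ D (n ^ e) q ⟩
  D ^ q * (n ^ e) ^ q        ≡⟨ cong (D ^ q *_) (^-*-assoc n e q) ⟩
  D ^ q * n ^ (e * q)        ≤⟨ *-monoʳ-≤ (D ^ q) (^-monoʳ-≤ n {{>-nonZero 1≤n}} (m≤m+n (e * q) p)) ⟩
  D ^ q * n ^ (e * q + p)    ∎
  where open ≤-Reasoning

algorithm : Algorithm TopologicalHittingSet
algorithm = record
  { program = main
  ; output  = λ I → answer-list (solution I)
  ; time    = λ I → duration (solution I)
  ; runs    = λ I → run-of (solution I)
  ; correct = λ I → is-answer (solution I)
  }
  where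
  open Solve
  open Solution

-- The constant is kept as a variable here, so that the weight of the concrete
-- program is never evaluated.
within-bounds : ∀ W →
  (∀ I → let open THSInstance I in Algorithm.time algorithm I ≤ W * (k * Δ) ^ (3 * k) * n ^ 6) →
  let open THSInstance
      open Algorithm algorithm in
  IsFPT algorithm (λ I → k I + Δ I)
  × ∃[ C ] ∃[ c ] ∀ (I : THSInstance) →
      time I ≤ (C * (k I * Δ I) ^ (c * k I)) · n I ^[ 6 +ω]
within-bounds W in-time =
  ( (λ x → (W + x) ^ (1 + 6 * x)) , 6 , bound-computable W
  , λ I → ≤-trans (in-time I) (*-mono-≤ (fpt-bound W (k I) (Δ I) (1≤Δ I)) (^-monoˡ-≤ 6 (n≤size I))))
  , W , 3
  , λ I → ω-bound _ (W * (k I * Δ I) ^ (3 * k I)) (n I) 6 (1≤n I) (in-time I)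
  where
  open THSInstance
  open Solve using (1≤Δ; 1≤n; n≤size)

theorem66 : Σ (Algorithm TopologicalHittingSet) λ A →
    let open THSInstance
        open Algorithm A in
    IsFPT A (λ I → k I + Δ I)
    × ∃[ C ] ∃[ c ] ∀ (I : THSInstance) →
        time I ≤ (C * (k I * Δ I) ^ (c * k I)) · n I ^[ 6 +ω]
theorem66 = algorithm , within-bounds (weight main) (λ I → Solve.Solution.in-time (Solve.solution I))
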